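{- Let $p$ be a prime number, $G$ a transitive group of degree $n\in p\mathbb{Z}\setminus p^{2}\mathbb{Z}$, and $H$ a corresponding subgroup of $G$. Assume that a $p$-Sylow subgroup $S_{p}$ of $G$ is normal and that $S_{p}\cong (C_{p})^{m}$ for some $m\neq 2$. Then $\operatorname{Sha}_{\mathcal{D}}^{2}(G,J_{G/H})[p^{\infty}]=0$ for every admissible set $\mathcal{D}$ of subgroups of $G$.
   Context: A transitive group of degree $n$ is a subgroup of $\mathfrak{S}_n$ acting transitively on $\{1,\dots,n\}$; a corresponding subgroup is a point stabilizer. $J_{G/H}$ is the cokernel of $\mathbb{Z}\to\operatorname{Ind}_H^G\mathbb{Z}=\mathrm{Hom}_{\mathbb{Z}[H]}(\mathbb{Z}[G],\mathbb{Z})$, $1\mapsto$ constant function $1$. $\operatorname{Sha}^2_{\mathcal{D}}(G,M):=\ker\big(H^2(G,M)\to\bigoplus_{D\in\mathcal{D}}H^2(D,M)\big)$. A finite set of subgroups is admissible if it contains all cyclic subgroups and is stable under conjugation. $A[p^\infty]$ is the $p$-primary torsion part. -}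

module Defs where

open import Level using (0ℓ)
open import Data.Nat as ℕ using (ℕ; zero; suc; NonZero)
open import Data.Nat.Divisibility using (_∣_)
open import Data.Nat.DivMod using (_mod_)
open import Data.Nat.Primality using (Prime; prime⇒nonZero)
open import Data.Integer as ℤ using (ℤ)
open import Data.Fin using (Fin; toℕ)
open import Data.Vec using (Vec; lookup; tabulate; zipWith)
open import Data.List using (List; length)
open import Data.List.Membership.Propositional using (_∈_)
open import Data.List.Relation.Unary.Any using (Any)
open import Data.List.Relation.Unary.Unique.Propositional using (Unique)
open import Data.Product using (Σ; ∃; ∃-syntax; _×_; _,_)
open import Relation.Binary.PropositionalEquality using (_≡_)
open import Relation.Nullary using (¬_)
open import Function using (id; _⇔_)

-- Permutations of {0,…,n-1}: σ is stored as the vector (σ 0, …, σ (n-1)).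

Perm : ℕ → Set
Perm n = Vec (Fin n) n

-- σ is a bijection (injective self-map of a finite set)
IsPerm : ∀ {n} → Perm n → Set
IsPerm σ = ∀ i j → lookup σ i ≡ lookup σ j → i ≡ j

_·ₚ_ : ∀ {n} → Perm n → Fin n → Fin n
σ ·ₚ i = lookup σ i

_*_ : ∀ {n} → Perm n → Perm n → Perm n
σ * τ = tabulate (λ i → lookup σ (lookup τ i))

idP : ∀ {n} → Perm n
idP = tabulate id

_^ₚ_ : ∀ {n} → Perm n → ℕ → Perm n
g ^ₚ zero  = idP
g ^ₚ suc k = g * (g ^ₚ k)

record Subgroup (n : ℕ) : Set where
  field
    elems     : List (Perm n)
    unique    : Unique elems
    perms     : ∀ {x} → x ∈ elems → IsPerm x
    has-id    : idP ∈ elems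
    mul-closed : ∀ {x y} → x ∈ elems → y ∈ elems → (x * y) ∈ elems
    inv-closed : ∀ {x} → x ∈ elems → ∃[ y ] (y ∈ elems × x * y ≡ idP)
open Subgroup public

_∈ˢ_ : ∀ {n} → Perm n → Subgroup n → Set
x ∈ˢ K = x ∈ elems K

order : ∀ {n} → Subgroup n → ℕ
order K = length (elems K)

_≤ˢ_ : ∀ {n} → Subgroup n → Subgroup n → Set
K ≤ˢ L = ∀ {x} → x ∈ˢ K → x ∈ˢ L

IsTransitive : ∀ {n} → Subgroup n → Set
IsTransitive {n} G = ∀ (i j : Fin n) → ∃[ g ] (g ∈ˢ G × g ·ₚ i ≡ j)

IsPointStabilizer : ∀ {n} → Subgroup n → Subgroup n → Fin n → Set
IsPointStabilizer G H i₀ = ∀ x → (x ∈ˢ H) ⇔ (x ∈ˢ G × x ·ₚ i₀ ≡ i₀)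

IsSylow : ∀ {n} → ℕ → Subgroup n → Subgroup n → Set
IsSylow p G S = S ≤ˢ G × ∃[ v ] ∃[ r ]
  (order S ≡ p ℕ.^ v × order G ≡ order S ℕ.* r × ¬ (p ∣ r))

IsNormal : ∀ {n} → Subgroup n → Subgroup n → Set
IsNormal G S = ∀ {g s} → g ∈ˢ G → s ∈ˢ S → ∃[ s' ] (s' ∈ˢ S × g * s ≡ s' * g)

module _ (p : ℕ) .{{_ : NonZero p}} where
  _+ᶜ_ : ∀ {m} → Vec (Fin p) m → Vec (Fin p) m → Vec (Fin p) m
  u +ᶜ v = zipWith (λ a b → (toℕ a ℕ.+ toℕ b) mod p) u v

IsoToCpPower : ∀ {n} (p : ℕ) → Prime p → ℕ → Subgroup n → Set
IsoToCpPower {n} p pr m S =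
  let instance _ = prime⇒nonZero pr in
  Σ (Vec (Fin p) m → Perm n) λ ι →
      (∀ u → ι u ∈ˢ S)
    × (∀ {s} → s ∈ˢ S → ∃[ u ] (ι u ≡ s))
    × (∀ u v → ι u ≡ ι v → u ≡ v)
    × (∀ u v → ι (_+ᶜ_ p u v) ≡ ι u * ι v)

SameElems : ∀ {n} → Subgroup n → Subgroup n → Set
SameElems K L = ∀ x → (x ∈ˢ K) ⇔ (x ∈ˢ L)

IsCyclicGenBy : ∀ {n} → Subgroup n → Perm n → Set
IsCyclicGenBy D g = ∀ x → (x ∈ˢ D) ⇔ (∃[ k ] (x ≡ g ^ₚ k))

IsConjugateBy : ∀ {n} → Perm n → Subgroup n → Subgroup n → Set
IsConjugateBy g K L = ∀ x → (x ∈ˢ L) ⇔ (∃[ k ] (k ∈ˢ K × x * g ≡ g * k))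

IsAdmissible : ∀ {n} → Subgroup n → List (Subgroup n) → Set
IsAdmissible G 𝒟 =
    (∀ {D} → D ∈ 𝒟 → D ≤ˢ G)
  × (∀ {g} → g ∈ˢ G → Any (λ D → IsCyclicGenBy D g) 𝒟)
  × (∀ {g D} → g ∈ˢ G → D ∈ 𝒟 → Any (IsConjugateBy g D) 𝒟)

-- The modules Ind_H^G ℤ and J_{G/H}, and H² with these coefficients.
--
-- Ind_H^G ℤ = Hom_{ℤ[H]}(ℤ[G], ℤ) is represented by functions
-- x : Perm n → ℤ (only values on G matter) with x(h y) = x(y) for h ∈ H,
-- with G acting by (g·x)(y) = x(y g).
-- J_{G/H} = Ind_H^G ℤ / ℤ·1 : representatives are elements of Ind, and
-- two are equal in J iff their difference is a constant function on G.

Cochain : ℕ → Set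
Cochain n = Perm n → ℤ

IsInd : ∀ {n} → Subgroup n → Subgroup n → Cochain n → Set
IsInd G H x = ∀ {h y} → h ∈ˢ H → y ∈ˢ G → x (h * y) ≡ x y

_≈J[_]_ : ∀ {n} → Cochain n → Subgroup n → Cochain n → Set
x ≈J[ G ] y = ∃[ c ] (∀ {z} → z ∈ˢ G → x z ≡ y z ℤ.+ c)

act : ∀ {n} → Perm n → Cochain n → Cochain n
act g x y = x (y * g)

_⊕_ : ∀ {n} → Cochain n → Cochain n → Cochain n
(x ⊕ y) z = x z ℤ.+ y z

_⊖_ : ∀ {n} → Cochain n → Cochain n → Cochain n
(x ⊖ y) z = x z ℤ.- y z

zeroJ : ∀ {n} → Cochain n
zeroJ _ = ℤ.0ℤ

Cochain2 : ℕ → Set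
Cochain2 n = Perm n → Perm n → Cochain n

Is2Cocycle : ∀ {n} → Subgroup n → Subgroup n → Cochain2 n → Set
Is2Cocycle G H f =
    (∀ {a b} → a ∈ˢ G → b ∈ˢ G → IsInd G H (f a b))
  × (∀ {a b c} → a ∈ˢ G → b ∈ˢ G → c ∈ˢ G →
       (((act a (f b c) ⊖ f (a * b) c) ⊕ f a (b * c)) ⊖ f a b) ≈J[ G ] zeroJ)

IsCoboundaryOn : ∀ {n} → Subgroup n → Subgroup n → Subgroup n → Cochain2 n → Set
IsCoboundaryOn {n} G H K f =
  Σ (Perm n → Cochain n) λ φ →
      (∀ {a} → a ∈ˢ K → IsInd G H (φ a))
    × (∀ {a b} → a ∈ˢ K → b ∈ˢ K →
         f a b ≈J[ G ] ((act a (φ b) ⊖ φ (a * b)) ⊕ φ a))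

scale2 : ∀ {n} → ℕ → Cochain2 n → Cochain2 n
scale2 k f a b z = ℤ.+ k ℤ.* f a b z

{-# OPTIONS --safe #-}

-- Evaluating at the points of Fin n turns f into a cocycle F with values in functions on
-- points modulo constants. If F bounds on S, then subtracting a coboundary makes it invariant
-- under left multiplication of its first argument by S, and summing that argument over S\G
-- bounds [G : S] F. As F is p-power torsion and p ∤ [G : S], it suffices to bound F on S.
--
-- On S we have |S| F = δ V, so V is a crossed homomorphism modulo |S| and constants, and F
-- bounds on S once V is principal in this sense. Since p² ∤ n and S is normal, S-orbits have
-- at most p points, so the powers of an element moving i are transitive on the S-orbit of i.
-- The constants in V define a central extension of S, which splits canonically over each
-- point stabilizer S_i; as F bounds on cyclic subgroups, these splittings agree on S_i ∩ S_j.
-- If m ≥ 3, three stabilizers in general position glue to a splitting over S which extends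
-- all the others. It corrects V to a crossed homomorphism vanishing at fixed points, and such
-- a crossed homomorphism is principal. If m ≤ 1, S is itself cyclic.

module Submission where

open import Defs
open import Level using (0ℓ)
open import Data.Nat as ℕ using (ℕ; zero; suc; _^_)
import Data.Nat.Properties as ℕₚ
open import Data.Nat.Coprimality using (Coprime; coprime-Bézout; coprime-divisor; prime⇒coprime)
  renaming (sym to coprime-sym)
open import Data.Nat.Divisibility
  using (_∣_; _∣?_; divides; ∣-refl; ∣-trans; ∣1⇒≡1; m∣m*n; *-monoˡ-∣)
open import Data.Nat.DivMod using (_mod_; _%_; m<n⇒m%n≡m; m%n<n; %-distribˡ-+; m*n%n≡0; %-congˡ)
open import Data.Nat.GCD using (module Bézout)
open import Data.Nat.Primality using (Prime; prime⇒nonZero; prime⇒nonTrivial; prime⇒irreducible)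
open import Data.Integer as ℤ using (ℤ; 0ℤ; 1ℤ; -_; _+_; _-_) renaming (_*_ to _·_)
import Data.Integer.Properties as ℤₚ
open import Data.Integer.Divisibility.Signed
  using (0∣⇒≡0; ∣m∣n⇒∣m+n; ∣m∣n⇒∣m-n; ∣m⇒∣-m; ∣n⇒∣m*n)
  renaming (_∣_ to _∣ᶻ_; divides to dividesᶻ)
open import Data.Integer.Tactic.RingSolver using (solve-∀)
open import Data.Fin as Fin using (Fin; zero; suc; toℕ; inject≤; funToFin; finToFun)
import Data.Fin.Properties as Finₚ
open import Data.Fin.Patterns using (0F; 1F; 2F)
open import Data.Vec as Vec using (Vec; []; _∷_; tabulate; lookup)
open import Data.Vec.Properties using (lookup∘tabulate; tabulate∘lookup; tabulate-cong; ≡-dec)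
open import Data.List
  using (List; []; _∷_; length; map; filter; foldr; allFin; cartesianProduct; deduplicate)
open import Data.List.Properties using (length-map; length-++; length-tabulate; map-∘)
open import Data.List.Membership.Propositional using (_∈_; find; lose)
open import Data.List.Membership.Propositional.Properties
open import Data.List.Membership.Propositional.Properties.WithK using (unique∧set⇒bag)
open import Data.List.Membership.Setoid.Properties using (index-injective)
open import Data.List.Relation.Binary.BagAndSetEquality using (∼bag⇒↭)
open import Data.List.Relation.Binary.Permutation.Propositional using (_↭_; ↭⇒↭ₛ)
import Data.List.Relation.Binary.Permutation.Propositional.Properties as ↭ₚ
import Data.List.Relation.Binary.Permutation.Setoid.Properties as ↭ₛ
import Data.List.Relation.Unary.All as All
import Data.List.Relation.Unary.All.Properties as Allₚ
open import Data.List.Relation.Unary.AllPairs as AllPairs using (AllPairs; []; _∷_)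
open import Data.List.Relation.Unary.Any as Any using (here; there)
import Data.List.Relation.Unary.Any.Properties as Anyₚ
open import Data.List.Relation.Unary.Unique.Propositional using (Unique)
import Data.List.Relation.Unary.Unique.Propositional.Properties as Uniqueₚ
open import Data.List.Relation.Unary.Unique.DecSetoid.Properties using (deduplicate-!)
open import Data.Product using (∃; ∃-syntax; _×_; _,_; proj₁; proj₂; uncurry)
open import Data.Sum using (inj₁; inj₂)
open import Function using (_∘_; id; mk⇔; Equivalence; Injective)
open import Relation.Binary.Bundles using (DecSetoid; Setoid)
import Relation.Binary.Construct.On as On
open import Relation.Binary.Definitions using (DecidableEquality)
open import Relation.Binary.PropositionalEquality
import Relation.Binary.Reasoning.Setoid as ≈-Reasoning
open import Relation.Nullary using (¬_; Dec; yes; no; contradiction)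
open import Relation.Nullary.Decidable using (map′)
open import Relation.Unary using (Pred; Decidable)

private
  variable
    n : ℕ
    N : ℤ
    A B : Set

-- Finite sets as lists without repetition

∃∈? : {P : Pred A 0ℓ} → Decidable P → (xs : List A) → Dec (∃[ x ] (x ∈ xs × P x))
∃∈? P? xs = map′ find (λ (_ , x∈ , Px) → lose x∈ Px) (Any.any? P? xs)

length-cartesianProduct : (xs : List A) (ys : List B) →
  length (cartesianProduct xs ys) ≡ length xs ℕ.* length ys
length-cartesianProduct [] ys = refl
length-cartesianProduct (x ∷ xs) ys = trans (length-++ (map (x ,_) ys))
  (cong₂ ℕ._+_ (length-map (x ,_) ys) (length-cartesianProduct xs ys))

unique-map⁺ : (f : A → B) {xs : List A} →
  (∀ {x y} → x ∈ xs → y ∈ xs → f x ≡ f y → x ≡ y) → Unique xs → Unique (map f xs)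
unique-map⁺ f inj [] = []
unique-map⁺ f inj (x∉xs ∷ xs!) =
  Allₚ.map⁺ (All.tabulate λ y∈ → All.lookup x∉xs y∈ ∘ inj (here refl) (there y∈))
  ∷ unique-map⁺ f (λ x∈ y∈ → inj (there x∈) (there y∈)) xs!

bijection⇒↭ : (f : A → B) {xs : List A} {ys : List B} → Unique xs → Unique ys →
  (∀ {x} → x ∈ xs → f x ∈ ys) →
  (∀ {x x′} → x ∈ xs → x′ ∈ xs → f x ≡ f x′ → x ≡ x′) →
  (∀ {y} → y ∈ ys → ∃[ x ] (x ∈ xs × f x ≡ y)) →
  map f xs ↭ ys
bijection⇒↭ f {xs} {ys} xs! ys! into inj onto =
  ∼bag⇒↭ (unique∧set⇒bag (unique-map⁺ f inj xs!) ys! (mk⇔ into′ onto′))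
  where
  into′ : ∀ {y} → y ∈ map f xs → y ∈ ys
  into′ y∈ with x , x∈ , refl ← ∈-map⁻ f y∈ = into x∈
  onto′ : ∀ {y} → y ∈ ys → y ∈ map f xs
  onto′ y∈ with x , x∈ , refl ← onto y∈ = ∈-map⁺ f x∈

allPairs-apart : {_~_ : A → A → Set} → (∀ {x y} → x ~ y → y ~ x) →
  {xs : List A} → AllPairs (λ x y → ¬ x ~ y) xs → ∀ {x y} → x ∈ xs → y ∈ xs → x ~ y → x ≡ y
allPairs-apart ~-sym (_ ∷ _) (here refl) (here refl) _ = refl
allPairs-apart ~-sym (≁ ∷ _) (here refl) (there y∈) x~y = contradiction x~y (All.lookup ≁ y∈)
allPairs-apart ~-sym (≁ ∷ _) (there x∈) (here refl) x~y = contradiction (~-sym x~y) (All.lookup ≁ x∈)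
allPairs-apart ~-sym (_ ∷ ≁s) (there x∈) (there y∈) x~y = allPairs-apart ~-sym ≁s x∈ y∈ x~y

module Representatives (E : DecSetoid 0ℓ 0ℓ) (xs : List (DecSetoid.Carrier E)) where

  open DecSetoid E using () renaming
    ( Carrier to X; _≈_ to _~_; _≟_ to _~?_; reflexive to ~-reflexive
    ; refl to ~-refl; sym to ~-sym; trans to ~-trans )

  reps : List X
  reps = deduplicate _~?_ xs

  reps⊆ : ∀ {r} → r ∈ reps → r ∈ xs
  reps⊆ = ∈-deduplicate⁻ _~?_ xs

  reps-unique : Unique reps
  reps-unique = AllPairs.map (λ r≁s r≡s → r≁s (~-reflexive r≡s)) (deduplicate-! E xs)

  reps-apart : ∀ {r s} → r ∈ reps → s ∈ reps → r ~ s → r ≡ s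
  reps-apart = allPairs-apart ~-sym (deduplicate-! E xs)

  represented : ∀ {x} → x ∈ xs → ∃[ r ] (r ∈ reps × x ~ r)
  represented x∈ = find
    (Anyₚ.deduplicate⁺ _~?_ (λ y~x z~x → ~-trans z~x (~-sym y~x)) (lose x∈ ~-refl))

  class-equation : {ks : List A} (c : A → X → X) → Unique ks → Unique xs →
    (∀ {k r} → k ∈ ks → r ∈ xs → c k r ∈ xs × r ~ c k r) →
    (∀ {k l r} → r ∈ xs → c k r ≡ c l r → k ≡ l) →
    (∀ {r x} → r ∈ xs → x ∈ xs → r ~ x → ∃[ k ] (k ∈ ks × c k r ≡ x)) →
    length ks ℕ.* length reps ≡ length xs
  class-equation {ks = ks} c ks! xs! into inj onto = begin
    length ks ℕ.* length reps            ≡⟨ length-cartesianProduct ks reps ⟨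
    length pairs                         ≡⟨ length-map (uncurry c) pairs ⟨
    length (map (uncurry c) pairs)       ≡⟨ ↭ₚ.↭-length enumeration ⟩
    length xs                            ∎
    where
    open ≡-Reasoning
    pairs : List (_ × X)
    pairs = cartesianProduct ks reps
    inj′ : ∀ {k r l s} → k ∈ ks × r ∈ reps → l ∈ ks × s ∈ reps → c k r ≡ c l s → (k , r) ≡ (l , s)
    inj′ (k∈ , r∈) (l∈ , s∈) eq
      with refl ← reps-apart r∈ s∈ (~-trans (proj₂ (into k∈ (reps⊆ r∈)))
                    (~-trans (~-reflexive eq) (~-sym (proj₂ (into l∈ (reps⊆ s∈)))))) =
      cong (_, _) (inj (reps⊆ r∈) eq)
    onto′ : ∀ {x} → x ∈ xs → ∃[ kr ] (kr ∈ pairs × uncurry c kr ≡ x)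
    onto′ x∈ = let (r , r∈ , x~r) = represented x∈
                   (k , k∈ , eq) = onto (reps⊆ r∈) x∈ (~-sym x~r)
               in (k , r) , ∈-cartesianProduct⁺ k∈ r∈ , eq
    enumeration : map (uncurry c) pairs ↭ xs
    enumeration = bijection⇒↭ (uncurry c) (Uniqueₚ.cartesianProduct⁺ ks! reps-unique) xs!
      (λ kr∈ → let (k∈ , r∈) = ∈-cartesianProduct⁻ ks reps kr∈ in proj₁ (into k∈ (reps⊆ r∈)))
      (λ kr∈ ls∈ → inj′ (∈-cartesianProduct⁻ ks reps kr∈) (∈-cartesianProduct⁻ ks reps ls∈))
      onto′

injective⇒surjective : ∀ {n} {f : Fin n → Fin n} → Injective _≡_ _≡_ f → ∀ i → ∃[ j ] f j ≡ i
injective⇒surjective {n} {f} f-inj i with Finₚ.any? (λ j → f j Finₚ.≟ i)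
... | yes found = found
... | no missed = contradiction (λ {j} {k} → g-inj {j} {k}) (Finₚ.<⇒notInjective (ℕₚ.n<1+n n))
  where
  g : Fin (suc n) → Fin n
  g zero = i
  g (suc j) = f j
  g-inj : Injective _≡_ _≡_ g
  g-inj {zero} {zero} _ = refl
  g-inj {zero} {suc j} eq = contradiction (j , sym eq) missed
  g-inj {suc j} {zero} eq = contradiction (j , eq) missed
  g-inj {suc j} {suc k} eq = cong suc (f-inj eq)

-- Permutations

module _ {n : ℕ} where

  _≟ₚ_ : DecidableEquality (Perm n)
  _≟ₚ_ = ≡-dec Finₚ._≟_

  *-act : (a b : Perm n) (i : Fin n) → (a * b) ·ₚ i ≡ a ·ₚ (b ·ₚ i)
  *-act a b i = lookup∘tabulate _ i

  idP-act : (i : Fin n) → idP ·ₚ i ≡ i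
  idP-act i = lookup∘tabulate id i

  perm-ext : {a b : Perm n} → (∀ i → a ·ₚ i ≡ b ·ₚ i) → a ≡ b
  perm-ext {a} {b} eq = trans (sym (tabulate∘lookup a)) (trans (tabulate-cong eq) (tabulate∘lookup b))

  *-assoc : (a b c : Perm n) → (a * b) * c ≡ a * (b * c)
  *-assoc a b c = perm-ext λ i → begin
    ((a * b) * c) ·ₚ i      ≡⟨ *-act (a * b) c i ⟩
    (a * b) ·ₚ (c ·ₚ i)     ≡⟨ *-act a b _ ⟩
    a ·ₚ (b ·ₚ (c ·ₚ i))    ≡⟨ cong (a ·ₚ_) (*-act b c i) ⟨
    a ·ₚ ((b * c) ·ₚ i)     ≡⟨ *-act a (b * c) i ⟨
    (a * (b * c)) ·ₚ i      ∎
    where open ≡-Reasoning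

  *-identityˡ : (a : Perm n) → idP * a ≡ a
  *-identityˡ a = perm-ext λ i → trans (*-act idP a i) (idP-act _)

  *-identityʳ : (a : Perm n) → a * idP ≡ a
  *-identityʳ a = perm-ext λ i → trans (*-act a idP i) (cong (a ·ₚ_) (idP-act i))

  *-fix : (a b : Perm n) {i : Fin n} → a ·ₚ i ≡ i → b ·ₚ i ≡ i → (a * b) ·ₚ i ≡ i
  *-fix a b {i} ai≡i bi≡i = trans (*-act a b i) (trans (cong (a ·ₚ_) bi≡i) ai≡i)

  *-moves : (a b : Perm n) {i : Fin n} → a ·ₚ i ≢ i → b ·ₚ i ≡ i → (a * b) ·ₚ i ≢ i
  *-moves a b {i} ai≢i bi≡i abi≡i =
    ai≢i (trans (cong (a ·ₚ_) (sym bi≡i)) (trans (sym (*-act a b i)) abi≡i))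

  ^ₚ-fix : (a : Perm n) {i : Fin n} → a ·ₚ i ≡ i → (k : ℕ) → (a ^ₚ k) ·ₚ i ≡ i
  ^ₚ-fix a {i} ai≡i zero = idP-act i
  ^ₚ-fix a {i} ai≡i (suc k) = *-fix a (a ^ₚ k) ai≡i (^ₚ-fix a ai≡i k)

  ^ₚ-+ : (a : Perm n) (k l : ℕ) → a ^ₚ (k ℕ.+ l) ≡ (a ^ₚ k) * (a ^ₚ l)
  ^ₚ-+ a zero l = sym (*-identityˡ _)
  ^ₚ-+ a (suc k) l = trans (cong (a *_) (^ₚ-+ a k l)) (sym (*-assoc a (a ^ₚ k) (a ^ₚ l)))

  ^ₚ-* : (a : Perm n) (k l : ℕ) → a ^ₚ (k ℕ.* l) ≡ (a ^ₚ l) ^ₚ k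
  ^ₚ-* a zero l = refl
  ^ₚ-* a (suc k) l = trans (^ₚ-+ a l (k ℕ.* l)) (cong ((a ^ₚ l) *_) (^ₚ-* a k l))

  moved-point : {a : Perm n} → a ≢ idP → ∃[ i ] a ·ₚ i ≢ i
  moved-point {a} a≢1 = Finₚ.¬∀⟶∃¬ n _ (λ i → (a ·ₚ i) Finₚ.≟ i)
    (λ fixes → a≢1 (perm-ext λ i → trans (fixes i) (sym (idP-act i))))

  preimage : Perm n → Fin n → Fin n
  preimage a i with Finₚ.any? (λ j → (a ·ₚ j) Finₚ.≟ i)
  ... | yes (j , _) = j
  ... | no _ = i

  infix 25 _⁻¹
  _⁻¹ : Perm n → Perm n
  a ⁻¹ = tabulate (preimage a)

-- Permutation groups

module _ {n : ℕ} (K : Subgroup n) {a : Perm n} (a∈ : a ∈ˢ K) where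

  ^ₚ-closed : (k : ℕ) → (a ^ₚ k) ∈ˢ K
  ^ₚ-closed zero = has-id K
  ^ₚ-closed (suc k) = mul-closed K a∈ (^ₚ-closed k)

  act-preimage : ∀ i → a ·ₚ preimage a i ≡ i
  act-preimage i with Finₚ.any? (λ j → (a ·ₚ j) Finₚ.≟ i)
  ... | yes (_ , eq) = eq
  ... | no none = contradiction (injective⇒surjective (perms K a∈ _ _) i) none

  act-⁻¹ : ∀ i → a ·ₚ (a ⁻¹ ·ₚ i) ≡ i
  act-⁻¹ i = trans (cong (a ·ₚ_) (lookup∘tabulate (preimage a) i)) (act-preimage i)

  ⁻¹-act : ∀ i → a ⁻¹ ·ₚ (a ·ₚ i) ≡ i
  ⁻¹-act i = perms K a∈ _ _ (act-⁻¹ (a ·ₚ i))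

  act≡⇒⁻¹-act≡ : ∀ {i j} → a ·ₚ i ≡ j → a ⁻¹ ·ₚ j ≡ i
  act≡⇒⁻¹-act≡ refl = ⁻¹-act _

  *-inverseʳ : a * a ⁻¹ ≡ idP
  *-inverseʳ = perm-ext λ i → trans (*-act a (a ⁻¹) i) (trans (act-⁻¹ i) (sym (idP-act i)))

  *-inverseˡ : a ⁻¹ * a ≡ idP
  *-inverseˡ = perm-ext λ i → trans (*-act (a ⁻¹) a i) (trans (⁻¹-act i) (sym (idP-act i)))

  a⁻¹[ab]≡b : ∀ b → a ⁻¹ * (a * b) ≡ b
  a⁻¹[ab]≡b b = trans (sym (*-assoc (a ⁻¹) a b)) (trans (cong (_* b) *-inverseˡ) (*-identityˡ b))

  a[a⁻¹b]≡b : ∀ b → a * (a ⁻¹ * b) ≡ b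
  a[a⁻¹b]≡b b = trans (sym (*-assoc a (a ⁻¹) b)) (trans (cong (_* b) *-inverseʳ) (*-identityˡ b))

  [ba⁻¹]a≡b : ∀ b → (b * a ⁻¹) * a ≡ b
  [ba⁻¹]a≡b b = trans (*-assoc b (a ⁻¹) a) (trans (cong (b *_) *-inverseˡ) (*-identityʳ b))

  [ba]a⁻¹≡b : ∀ b → (b * a) * a ⁻¹ ≡ b
  [ba]a⁻¹≡b b = trans (*-assoc b a (a ⁻¹)) (trans (cong (b *_) *-inverseʳ) (*-identityʳ b))

  *-cancelˡ : ∀ {b c} → a * b ≡ a * c → b ≡ c
  *-cancelˡ {b} {c} eq = trans (sym (a⁻¹[ab]≡b b)) (trans (cong (a ⁻¹ *_) eq) (a⁻¹[ab]≡b c))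

  *-cancelʳ : ∀ {b c} → b * a ≡ c * a → b ≡ c
  *-cancelʳ {b} {c} eq = trans (sym ([ba]a⁻¹≡b b)) (trans (cong (_* a ⁻¹) eq) ([ba]a⁻¹≡b c))

  ⁻¹*-fix : ∀ b {i} → b ·ₚ i ≡ a ·ₚ i → (a ⁻¹ * b) ·ₚ i ≡ i
  ⁻¹*-fix b {i} eq = trans (*-act (a ⁻¹) b i) (act≡⇒⁻¹-act≡ (sym eq))

  ⁻¹-closed : (a ⁻¹) ∈ˢ K
  ⁻¹-closed with b , b∈ , ab≡1 ← inv-closed K a∈ =
    subst (_∈ˢ K) (*-cancelˡ (trans ab≡1 (sym *-inverseʳ))) b∈

  right-translate-↭ : map (_* a) (elems K) ↭ elems K
  right-translate-↭ = bijection⇒↭ (_* a) (unique K) (unique K)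
    (λ x∈ → mul-closed K x∈ a∈)
    (λ _ _ → *-cancelʳ)
    (λ {x} x∈ → x * a ⁻¹ , mul-closed K x∈ ⁻¹-closed , [ba⁻¹]a≡b x)

choose : {n : ℕ} (K : Subgroup n) {B : Set} {P : Perm n → B → Set} → B →
  (∀ {a} → a ∈ˢ K → ∃ (P a)) → ∃[ f ] (∀ {a} → a ∈ˢ K → P a (f a))
choose K {B} {P} default ∃P = f , f-spec
  where
  open import Data.List.Membership.DecPropositional _≟ₚ_ using (_∈?_)
  f : Perm _ → B
  f a with a ∈? elems K
  ... | yes a∈ = proj₁ (∃P a∈)
  ... | no _ = default
  f-spec : ∀ {a} → a ∈ˢ K → P a (f a)
  f-spec {a} a∈ with a ∈? elems K
  ... | yes a∈′ = proj₂ (∃P a∈′)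
  ... | no a∉ = contradiction a∈ a∉

module Orbits {n : ℕ} (K : Subgroup n) {X : Set} (_≟_ : DecidableEquality X)
  (_▷_ : Perm n → X → X) (idP-▷ : ∀ x → idP ▷ x ≡ x)
  (*-▷ : ∀ a b x → (a * b) ▷ x ≡ a ▷ (b ▷ x)) where

  record _~_ (x y : X) : Set where
    constructor moved-by
    field
      {a} : Perm n
      a∈  : a ∈ˢ K
      a▷x : a ▷ x ≡ y

  _~?_ : ∀ x y → Dec (x ~ y)
  x ~? y = map′ (λ (_ , a∈ , eq) → moved-by a∈ eq) (λ (moved-by a∈ eq) → _ , a∈ , eq)
    (∃∈? (λ a → (a ▷ x) ≟ y) (elems K))

  ~-refl : ∀ {x} → x ~ x
  ~-refl = moved-by (has-id K) (idP-▷ _)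

  ~-sym : ∀ {x y} → x ~ y → y ~ x
  ~-sym {x} (moved-by {a} a∈ refl) = moved-by (⁻¹-closed K a∈)
    (trans (sym (*-▷ (a ⁻¹) a x)) (trans (cong (_▷ x) (*-inverseˡ K a∈)) (idP-▷ x)))

  ~-trans : ∀ {x y z} → x ~ y → y ~ z → x ~ z
  ~-trans (moved-by {a} a∈ refl) (moved-by {b} b∈ refl) = moved-by (mul-closed K b∈ a∈) (*-▷ b a _)

  ~-decSetoid : DecSetoid 0ℓ 0ℓ
  ~-decSetoid = record
    { _≈_ = _~_
    ; isDecEquivalence = record
      { isEquivalence = record { refl = ~-refl ; sym = ~-sym ; trans = ~-trans }
      ; _≟_ = _~?_ } }

module _ (K : Subgroup n) (i : Fin n) where

  private
    fixes? : Decidable (λ a → a ·ₚ i ≡ i)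
    fixes? a = (a ·ₚ i) Finₚ.≟ i

    ∈-fixing⁻ : ∀ {a} → a ∈ filter fixes? (elems K) → a ∈ˢ K × a ·ₚ i ≡ i
    ∈-fixing⁻ = ∈-filter⁻ fixes? {xs = elems K}

  stabilizer : Subgroup n
  stabilizer = record
    { elems = filter fixes? (elems K)
    ; unique = Uniqueₚ.filter⁺ fixes? (unique K)
    ; perms = λ a∈ → perms K (proj₁ (∈-fixing⁻ a∈))
    ; has-id = ∈-filter⁺ fixes? (has-id K) (idP-act i)
    ; mul-closed = λ {a} {b} a∈ b∈ →
        let (a∈K , ai≡i) = ∈-fixing⁻ a∈ ; (b∈K , bi≡i) = ∈-fixing⁻ b∈ in
        ∈-filter⁺ fixes? (mul-closed K a∈K b∈K) (*-fix a b ai≡i bi≡i)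
    ; inv-closed = λ {a} a∈ → let (a∈K , ai≡i) = ∈-fixing⁻ a∈ in
        a ⁻¹ , ∈-filter⁺ fixes? (⁻¹-closed K a∈K) (act≡⇒⁻¹-act≡ K a∈K ai≡i) , *-inverseʳ K a∈K }

  stabilizer⁺ : ∀ {a} → a ∈ˢ K → a ·ₚ i ≡ i → a ∈ˢ stabilizer
  stabilizer⁺ = ∈-filter⁺ fixes?

  stabilizer⁻ : ∀ {a} → a ∈ˢ stabilizer → a ∈ˢ K × a ·ₚ i ≡ i
  stabilizer⁻ = ∈-fixing⁻

IsAbelian OrbitsSweptByPowers : Subgroup n → Set
IsAbelian K = ∀ {a b} → a ∈ˢ K → b ∈ˢ K → a * b ≡ b * a
OrbitsSweptByPowers K =
  ∀ {e b i} → e ∈ˢ K → b ∈ˢ K → e ·ₚ i ≢ i → ∃[ k ] b ·ₚ i ≡ (e ^ₚ k) ·ₚ i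

adjust-to-fix : (K : Subgroup n) → OrbitsSweptByPowers K →
  ∀ {e b i} → e ∈ˢ K → b ∈ˢ K → e ·ₚ i ≢ i → ∃[ k ] (b * (e ^ₚ k)) ·ₚ i ≡ i
adjust-to-fix K swept {e} {b} {i} e∈ b∈ moves with k , eq ← swept e∈ (⁻¹-closed K b∈) moves =
  k , trans (*-act b (e ^ₚ k) i) (trans (cong (b ·ₚ_) (sym eq)) (act-⁻¹ K b∈ i))

-- Arithmetic

∤⇒coprime : ∀ {p d} → Prime p → ¬ (p ∣ d) → Coprime d p
∤⇒coprime pr p∤d (e∣d , e∣p) with prime⇒irreducible pr e∣p
... | inj₁ e≡1 = e≡1
... | inj₂ refl = contradiction e∣d p∤d

coprime-^ʳ : ∀ {d p} → Coprime d p → ∀ k → Coprime d (p ^ k)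
coprime-^ʳ d⊥p zero (_ , e∣1) = ∣1⇒≡1 e∣1
coprime-^ʳ d⊥p (suc k) (e∣d , e∣p^k+1) = coprime-^ʳ d⊥p k
  (e∣d , coprime-divisor (λ (c∣e , c∣p) → d⊥p (∣-trans c∣e e∣d , c∣p)) e∣p^k+1)

∣p^v∧p²∤⇒≤p : ∀ {p d} → Prime p → ∀ v → d ∣ p ^ v → ¬ (p ^ 2 ∣ d) → d ℕ.≤ p
∣p^v∧p²∤⇒≤p {p} {d} pr v d∣p^v p²∤d with p ∣? d
... | no p∤d = subst (ℕ._≤ p) (sym (coprime-^ʳ (∤⇒coprime pr p∤d) v (∣-refl , d∣p^v)))
  (ℕ.>-nonZero⁻¹ p {{prime⇒nonZero pr}})
... | yes (divides q refl) = ℕₚ.≤-reflexive (trans (cong (ℕ._* p) q≡1) (ℕₚ.*-identityˡ p))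
  where
  p∤q : ¬ (p ∣ q)
  p∤q p∣q = p²∤d (subst (_∣ q ℕ.* p) (cong (p ℕ.*_) (sym (ℕₚ.*-identityʳ p))) (*-monoˡ-∣ p p∣q))
  q≡1 : q ≡ 1
  q≡1 = coprime-^ʳ (∤⇒coprime pr p∤q) v (∣-refl , ∣-trans (m∣m*n p) d∣p^v)

-- Orbits

module _ (K : Subgroup n) (i : Fin n) where

  open Representatives (On.decSetoid (Finₚ.≡-decSetoid n) (_·ₚ i)) (elems K)

  orbit : List (Fin n)
  orbit = map (_·ₚ i) reps

  orbit-unique : Unique orbit
  orbit-unique = unique-map⁺ (_·ₚ i) reps-apart reps-unique

  orbit⁺ : ∀ {a} → a ∈ˢ K → (a ·ₚ i) ∈ orbit
  orbit⁺ a∈ with r , r∈ , ai≡ri ← represented a∈ = subst (_∈ orbit) (sym ai≡ri) (∈-map⁺ (_·ₚ i) r∈)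

  orbit⁻ : ∀ {j} → j ∈ orbit → ∃[ a ] (a ∈ˢ K × a ·ₚ i ≡ j)
  orbit⁻ j∈ with r , r∈ , refl ← ∈-map⁻ (_·ₚ i) j∈ = r , reps⊆ r∈ , refl

  orbit-stabilizer : order (stabilizer K i) ℕ.* length orbit ≡ order K
  orbit-stabilizer = trans (cong (order (stabilizer K i) ℕ.*_) (length-map (_·ₚ i) reps))
    (class-equation (λ s r → r * s) (unique (stabilizer K i)) (unique K)
      into (λ r∈ → *-cancelˡ K r∈) onto)
    where
    into : ∀ {s r} → s ∈ˢ stabilizer K i → r ∈ˢ K → (r * s) ∈ˢ K × r ·ₚ i ≡ (r * s) ·ₚ i
    into {s} {r} s∈ r∈ = let (s∈K , si≡i) = stabilizer⁻ K i s∈ in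
      mul-closed K r∈ s∈K , sym (trans (*-act r s i) (cong (r ·ₚ_) si≡i))
    onto : ∀ {r x} → r ∈ˢ K → x ∈ˢ K → r ·ₚ i ≡ x ·ₚ i → ∃[ s ] (s ∈ˢ stabilizer K i × r * s ≡ x)
    onto {r} {x} r∈ x∈ ri≡xi = r ⁻¹ * x ,
      stabilizer⁺ K i (mul-closed K (⁻¹-closed K r∈) x∈) (⁻¹*-fix K r∈ x (sym ri≡xi)) ,
      a[a⁻¹b]≡b K r∈ x

  orbit-length-∣-order : length orbit ∣ order K
  orbit-length-∣-order = divides (order (stabilizer K i)) (sym orbit-stabilizer)

  orbitIndex : ∀ {q} → length orbit ℕ.≤ q → ∀ {a} → a ∈ˢ K → Fin q
  orbitIndex |orbit|≤q a∈ = inject≤ (Any.index (orbit⁺ a∈)) |orbit|≤q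

  orbitIndex-injective : ∀ {q} (|orbit|≤q : length orbit ℕ.≤ q) {a b} (a∈ : a ∈ˢ K) (b∈ : b ∈ˢ K) →
    orbitIndex |orbit|≤q a∈ ≡ orbitIndex |orbit|≤q b∈ → a ·ₚ i ≡ b ·ₚ i
  orbitIndex-injective |orbit|≤q a∈ b∈ eq = index-injective (setoid _) (orbit⁺ a∈) (orbit⁺ b∈)
    (Finₚ.inject≤-injective |orbit|≤q |orbit|≤q _ _ eq)

normal⇒orbit-translate : (G S : Subgroup n) → IsNormal G S →
  ∀ {g i o} → g ∈ˢ G → o ∈ orbit S i → (g ·ₚ o) ∈ orbit S (g ·ₚ i)
normal⇒orbit-translate G S normal {g} {i} g∈ o∈
  with s , s∈ , refl ← orbit⁻ S i o∈ with s′ , s′∈ , gs≡s′g ← normal g∈ s∈ =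
  subst (_∈ orbit S (g ·ₚ i)) (begin
    s′ ·ₚ (g ·ₚ i)    ≡⟨ *-act s′ g i ⟨
    (s′ * g) ·ₚ i     ≡⟨ cong (_·ₚ i) gs≡s′g ⟨
    (g * s) ·ₚ i      ≡⟨ *-act g s i ⟩
    g ·ₚ (s ·ₚ i)     ∎)
    (orbit⁺ S (g ·ₚ i) s′∈)
  where open ≡-Reasoning

normal⇒orbit-length-∣-degree : (G S : Subgroup n) → IsTransitive G → IsNormal G S →
  ∀ i → length (orbit S i) ∣ n
normal⇒orbit-length-∣-degree {n} G S transitive normal i =
  divides (length reps) (sym (trans (ℕₚ.*-comm (length reps) (length (orbit S i)))
    (trans equal-classes (length-tabulate id))))
  where
  open Orbits S Finₚ._≟_ _·ₚ_ idP-act *-act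
  open Representatives ~-decSetoid (allFin n)
  g : Fin n → Perm n
  g r = proj₁ (transitive i r)
  g∈ : ∀ r → g r ∈ˢ G
  g∈ r = proj₁ (proj₂ (transitive i r))
  g-act : ∀ r → g r ·ₚ i ≡ r
  g-act r = proj₂ (proj₂ (transitive i r))
  translate-into : ∀ {o r} → o ∈ orbit S i → r ~ (g r ·ₚ o)
  translate-into {o} {r} o∈ =
    let (_ , s∈ , eq) = orbit⁻ S r (subst (λ j → (g r ·ₚ o) ∈ orbit S j) (g-act r)
                          (normal⇒orbit-translate G S normal (g∈ r) o∈))
    in moved-by s∈ eq
  translate-onto : ∀ {r x} → r ~ x → ∃[ o ] (o ∈ orbit S i × g r ·ₚ o ≡ x)
  translate-onto {r} (moved-by {s} s∈ refl) = g r ⁻¹ ·ₚ (s ·ₚ r) ,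
    subst (λ j → (g r ⁻¹ ·ₚ (s ·ₚ r)) ∈ orbit S j) (act≡⇒⁻¹-act≡ G (g∈ r) (g-act r))
      (normal⇒orbit-translate G S normal (⁻¹-closed G (g∈ r)) (orbit⁺ S r s∈)) ,
    act-⁻¹ G (g∈ r) (s ·ₚ r)
  equal-classes : length (orbit S i) ℕ.* length reps ≡ length (allFin n)
  equal-classes = class-equation (λ o r → g r ·ₚ o) (orbit-unique S i) (Uniqueₚ.allFin⁺ n)
    (λ o∈ _ → ∈-allFin _ , translate-into o∈)
    (λ {_} {_} {r} _ → perms G (g∈ r) _ _)
    (λ _ _ → translate-onto)

OrbitsBoundedBy : ℕ → Subgroup n → Set
OrbitsBoundedBy q K = ∀ i → length (orbit K i) ℕ.≤ q

normal-p-subgroup-orbits-bounded : ∀ {p v} → Prime p → ¬ (p ^ 2 ∣ n) → (G S : Subgroup n) →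
  IsTransitive G → IsNormal G S → order S ≡ p ^ v → OrbitsBoundedBy p S
normal-p-subgroup-orbits-bounded {v = v} pr p²∤n G S transitive normal |S|≡p^v i =
  ∣p^v∧p²∤⇒≤p pr v (subst (length (orbit S i) ∣_) |S|≡p^v (orbit-length-∣-order S i))
    (λ p²∣ → p²∤n (∣-trans p²∣ (normal⇒orbit-length-∣-degree G S transitive normal i)))

-- Elements of prime order

module _ {e : Perm n} {i : Fin n} where

  ^ₚ-fix-consecutive : ∀ x y {k l} → 1 ℕ.+ y ℕ.* l ≡ x ℕ.* k →
    (e ^ₚ k) ·ₚ i ≡ i → (e ^ₚ l) ·ₚ i ≡ i → e ·ₚ i ≡ i
  ^ₚ-fix-consecutive x y {k} {l} 1+yl≡xk fix-k fix-l = begin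
    e ·ₚ i                          ≡⟨ cong (e ·ₚ_) (multiple-fix y fix-l) ⟨
    e ·ₚ ((e ^ₚ (y ℕ.* l)) ·ₚ i)    ≡⟨ *-act e (e ^ₚ (y ℕ.* l)) i ⟨
    (e ^ₚ (1 ℕ.+ y ℕ.* l)) ·ₚ i     ≡⟨ cong (λ m → (e ^ₚ m) ·ₚ i) 1+yl≡xk ⟩
    (e ^ₚ (x ℕ.* k)) ·ₚ i           ≡⟨ multiple-fix x fix-k ⟩
    i                               ∎
    where
    open ≡-Reasoning
    multiple-fix : ∀ x {k} → (e ^ₚ k) ·ₚ i ≡ i → (e ^ₚ (x ℕ.* k)) ·ₚ i ≡ i
    multiple-fix x {k} fix = trans (cong (_·ₚ i) (^ₚ-* e x k)) (^ₚ-fix (e ^ₚ k) fix x)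

  ^ₚ-fix-coprime : ∀ {k l} → Coprime k l → (e ^ₚ k) ·ₚ i ≡ i → (e ^ₚ l) ·ₚ i ≡ i → e ·ₚ i ≡ i
  ^ₚ-fix-coprime k⊥l fix-k fix-l with coprime-Bézout k⊥l
  ... | Bézout.+- x y eq = ^ₚ-fix-consecutive x y eq fix-k fix-l
  ... | Bézout.-+ x y eq = ^ₚ-fix-consecutive y x eq fix-l fix-k

HasExponent : ℕ → Subgroup n → Set
HasExponent q K = ∀ {e} → e ∈ˢ K → e ^ₚ q ≡ idP

module _ {p : ℕ} (pr : Prime p) (K : Subgroup n) (exponent : HasExponent p K) where

  prime-powers-distinct : ∀ {e i k l} → e ∈ˢ K → e ·ₚ i ≢ i → k ℕ.< l → l ℕ.< p →
    (e ^ₚ k) ·ₚ i ≢ (e ^ₚ l) ·ₚ i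
  prime-powers-distinct {e} {i} {k} {l} e∈ moves k<l l<p eq =
    moves (^ₚ-fix-coprime (coprime-sym (prime⇒coprime pr l∸k<p)) fix-l∸k
      (trans (cong (_·ₚ i) (exponent e∈)) (idP-act i)))
    where
    open ≡-Reasoning
    instance
      l∸k≢0 : ℕ.NonZero (l ℕ.∸ k)
      l∸k≢0 = ℕ.>-nonZero (ℕₚ.m<n⇒0<n∸m k<l)
    l∸k<p : l ℕ.∸ k ℕ.< p
    l∸k<p = ℕₚ.≤-<-trans (ℕₚ.m∸n≤m l k) l<p
    fix-l∸k : (e ^ₚ (l ℕ.∸ k)) ·ₚ i ≡ i
    fix-l∸k = perms K (^ₚ-closed K e∈ k) _ _ (begin
      (e ^ₚ k) ·ₚ ((e ^ₚ (l ℕ.∸ k)) ·ₚ i)  ≡⟨ *-act (e ^ₚ k) (e ^ₚ (l ℕ.∸ k)) i ⟨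
      ((e ^ₚ k) * (e ^ₚ (l ℕ.∸ k))) ·ₚ i   ≡⟨ cong (_·ₚ i) (^ₚ-+ e k (l ℕ.∸ k)) ⟨
      (e ^ₚ (k ℕ.+ (l ℕ.∸ k))) ·ₚ i        ≡⟨ cong (λ m → (e ^ₚ m) ·ₚ i) (ℕₚ.m+[n∸m]≡n (ℕₚ.<⇒≤ k<l)) ⟩
      (e ^ₚ l) ·ₚ i                        ≡⟨ eq ⟨
      (e ^ₚ k) ·ₚ i                        ∎)

  -- Among b i, i, e i, …, eᵖ⁻¹ i two points coincide, and the powers of e give distinct points.
  bounded-orbits⇒swept : OrbitsBoundedBy p K → OrbitsSweptByPowers K
  bounded-orbits⇒swept bounded {e} {b} {i} e∈ b∈ moves
    with Finₚ.pigeonhole (ℕₚ.n<1+n p) (λ x → orbitIndex K i (bounded i) (candidate∈ x))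
    where
    candidate : Fin (suc p) → Perm n
    candidate zero = b
    candidate (suc k) = e ^ₚ toℕ k
    candidate∈ : ∀ x → candidate x ∈ˢ K
    candidate∈ zero = b∈
    candidate∈ (suc k) = ^ₚ-closed K e∈ (toℕ k)
  ... | zero , suc k , _ , eq =
    toℕ k , orbitIndex-injective K i (bounded i) b∈ (^ₚ-closed K e∈ (toℕ k)) eq
  ... | suc k , suc l , ℕ.s<s k<l , eq = contradiction
    (orbitIndex-injective K i (bounded i) (^ₚ-closed K e∈ (toℕ k)) (^ₚ-closed K e∈ (toℕ l)) eq)
    (prime-powers-distinct e∈ moves k<l (Finₚ.toℕ<n l))

-- Points in general position

funToFin-cong : ∀ {q m} {f g : Fin m → Fin q} → f ≗ g → funToFin f ≡ funToFin g
funToFin-cong {m = zero} f≗g = refl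
funToFin-cong {m = suc m} f≗g = cong₂ Fin.combine (f≗g zero) (funToFin-cong (f≗g ∘ suc))

finToFun-injective : ∀ {q} m (x y : Fin (q ^ m)) → finToFun {q} {m} x ≗ finToFun y → x ≡ y
finToFun-injective {q} m x y x≗y = begin
  x                                 ≡⟨ Finₚ.funToFin-finToFin {m} {q} x ⟨
  funToFin (finToFun {q} {m} x)     ≡⟨ funToFin-cong x≗y ⟩
  funToFin (finToFun {q} {m} y)     ≡⟨ Finₚ.funToFin-finToFin {m} {q} y ⟩
  y                                 ∎
  where open ≡-Reasoning

CommonStabilizersNontrivial : Subgroup n → ℕ → Set
CommonStabilizersNontrivial {n} K k = (point : Fin k → Fin n) →
  ∃[ a ] (a ∈ˢ K × a ≢ idP × (∀ j → a ·ₚ point j ≡ point j))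

bounded-orbits⇒common-stabilizers-nontrivial : ∀ {q r k} (K : Subgroup n) → OrbitsBoundedBy q K →
  (s : Fin r → Perm n) → (∀ x → s x ∈ˢ K) → Injective _≡_ _≡_ s → q ^ k ℕ.< r →
  CommonStabilizersNontrivial K k
bounded-orbits⇒common-stabilizers-nontrivial {n} {q} {r} {k} K bounded s s∈ s-inj q^k<r point =
  let (x , y , x<y , eq) = Finₚ.pigeonhole q^k<r (funToFin ∘ images) in
  s y ⁻¹ * s x , mul-closed K (⁻¹-closed K (s∈ y)) (s∈ x) ,
  (λ y⁻¹x≡1 → Finₚ.<⇒≢ x<y (s-inj (quotient≡idP x y y⁻¹x≡1))) ,
  λ j → ⁻¹*-fix K (s∈ y) (s x) (same-image x y eq j)
  where
  open ≡-Reasoning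
  images : Fin r → Fin k → Fin q
  images x j = orbitIndex K (point j) (bounded (point j)) (s∈ x)
  quotient≡idP : ∀ x y → s y ⁻¹ * s x ≡ idP → s x ≡ s y
  quotient≡idP x y y⁻¹x≡1 = begin
    s x                      ≡⟨ a[a⁻¹b]≡b K (s∈ y) (s x) ⟨
    s y * (s y ⁻¹ * s x)     ≡⟨ cong (s y *_) y⁻¹x≡1 ⟩
    s y * idP                ≡⟨ *-identityʳ (s y) ⟩
    s y                      ∎
  same-image : ∀ x y → funToFin (images x) ≡ funToFin (images y) →
    ∀ j → s x ·ₚ point j ≡ s y ·ₚ point j
  same-image x y eq j = orbitIndex-injective K (point j) (bounded (point j)) (s∈ x) (s∈ y) (begin
    images x j                         ≡⟨ Finₚ.finToFun-funToFin (images x) j ⟨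
    finToFun (funToFin (images x)) j   ≡⟨ cong (λ z → finToFun z j) eq ⟩
    finToFun (funToFin (images y)) j   ≡⟨ Finₚ.finToFun-funToFin (images y) j ⟩
    images y j                         ∎)

record DualSystem (K : Subgroup n) (k : ℕ) : Set where
  field
    point    : Fin k → Fin n
    element  : Fin k → Perm n
    element∈ : ∀ j → element j ∈ˢ K
    moves    : ∀ j → element j ·ₚ point j ≢ point j
    fixes    : ∀ {j l} → j ≢ l → element j ·ₚ point l ≡ point l

  component : OrbitsSweptByPowers K → ∀ j {a} → a ∈ˢ K →
    ∃[ x ] (x ∈ˢ K × x ·ₚ point j ≡ a ·ₚ point j × (∀ {l} → j ≢ l → x ·ₚ point l ≡ point l))
  component swept j a∈ with k , eq ← swept (element∈ j) a∈ (moves j) =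
    element j ^ₚ k , ^ₚ-closed K (element∈ j) k , sym eq , λ j≢l → ^ₚ-fix (element j) (fixes j≢l) k

extend-dualSystem : (K : Subgroup n) → OrbitsSweptByPowers K → ∀ {k} (D : DualSystem K k) →
  ∀ {a} → a ∈ˢ K → a ≢ idP → (∀ j → a ·ₚ DualSystem.point D j ≡ DualSystem.point D j) →
  DualSystem K (suc k)
extend-dualSystem K swept {k} D {a} a∈ a≢1 a-fixes with i , a-moves ← moved-point a≢1 = record
  { point    = λ { zero → i ; (suc j) → point j }
  ; element  = λ { zero → a ; (suc j) → corrected j }
  ; element∈ = λ { zero → a∈ ; (suc j) → mul-closed K (element∈ j) (^ₚ-closed K a∈ (exponent j)) }
  ; moves    = λ { zero → a-moves
                 ; (suc j) →
                     *-moves (element j) (a ^ₚ exponent j) (moves j) (power-fixes (exponent j) j) }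
  ; fixes    = λ { {zero} {zero} 0≢0 → contradiction refl 0≢0
                 ; {zero} {suc l} _ → a-fixes l
                 ; {suc j} {zero} _ → proj₂ (adjust-to-fix K swept a∈ (element∈ j) a-moves)
                 ; {suc j} {suc l} j≢l →
                     *-fix (element j) (a ^ₚ exponent j)
                       (fixes (j≢l ∘ cong suc)) (power-fixes (exponent j) l) } }
  where
  open DualSystem D
  exponent : Fin k → ℕ
  exponent j = proj₁ (adjust-to-fix K swept a∈ (element∈ j) a-moves)
  corrected : Fin k → Perm _
  corrected j = element j * (a ^ₚ exponent j)
  power-fixes : ∀ m l → (a ^ₚ m) ·ₚ point l ≡ point l
  power-fixes m l = ^ₚ-fix a (a-fixes l) m

dualSystem : (K : Subgroup n) → OrbitsSweptByPowers K → ∀ {m} →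
  (∀ {k} → k ℕ.< m → CommonStabilizersNontrivial K k) → ∀ k → k ℕ.≤ m → DualSystem K k
dualSystem K swept nontrivial zero _ = record
  { point = λ () ; element = λ () ; element∈ = λ () ; moves = λ () ; fixes = λ { {()} } }
dualSystem K swept nontrivial (suc k) k<m =
  let D = dualSystem K swept nontrivial k (ℕₚ.<⇒≤ k<m)
      (a , a∈ , a≢1 , a-fixes) = nontrivial k<m (DualSystem.point D)
  in extend-dualSystem K swept D a∈ a≢1 a-fixes

-- Sums and congruences

∑ : List A → (A → ℤ) → ℤ
∑ xs f = foldr _+_ 0ℤ (map f xs)

∑-reindex : (g : A → A) (f : A → ℤ) {xs : List A} → map g xs ↭ xs → ∑ xs (f ∘ g) ≡ ∑ xs f
∑-reindex g f {xs} p = trans (cong (foldr _+_ 0ℤ) (map-∘ xs))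
  (↭ₛ.foldr-commMonoid (setoid ℤ) ℤₚ.+-0-isCommutativeMonoid (↭⇒↭ₛ (↭ₚ.map⁺ f p)))

∑-distrib-+ : (f g : A → ℤ) (xs : List A) → ∑ xs (λ x → f x + g x) ≡ ∑ xs f + ∑ xs g
∑-distrib-+ f g [] = refl
∑-distrib-+ f g (x ∷ xs) =
  trans (cong (f x + g x +_) (∑-distrib-+ f g xs)) (interchange (f x) (g x) (∑ xs f) (∑ xs g))
  where
  interchange : ∀ a b c d → a + b + (c + d) ≡ a + c + (b + d)
  interchange = solve-∀

∑-distrib-- : (f g : A → ℤ) (xs : List A) → ∑ xs (λ x → f x - g x) ≡ ∑ xs f - ∑ xs g
∑-distrib-- f g [] = refl
∑-distrib-- f g (x ∷ xs) =
  trans (cong (f x - g x +_) (∑-distrib-- f g xs)) (interchange (f x) (g x) (∑ xs f) (∑ xs g))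
  where
  interchange : ∀ a b c d → a - b + (c - d) ≡ a + c - (b + d)
  interchange = solve-∀

∑-const : (c : ℤ) (xs : List A) → ∑ xs (λ _ → c) ≡ ℤ.+ length xs · c
∑-const c [] = refl
∑-const c (x ∷ xs) = trans (cong (c +_) (∑-const c xs)) (suc-· c (ℤ.+ length xs))
  where
  suc-· : ∀ c l → c + l · c ≡ (1ℤ + l) · c
  suc-· = solve-∀

infix 4 _≈_[mod_]
record _≈_[mod_] (x y N : ℤ) : Set where
  constructor mod-∣
  field N∣x-y : N ∣ᶻ x - y

open _≈_[mod_]

≈-by-difference : ∀ {x y x′ y′} → x ≈ y [mod N ] → x - y ≡ x′ - y′ → x′ ≈ y′ [mod N ]
≈-by-difference (mod-∣ d) eq = mod-∣ (subst (_ ∣ᶻ_) eq d)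

≈-reflexive : ∀ {x y} → x ≡ y → x ≈ y [mod N ]
≈-reflexive {x = x} refl = mod-∣ (dividesᶻ 0ℤ (ℤₚ.+-inverseʳ x))

≈-refl : ∀ {x} → x ≈ x [mod N ]
≈-refl = ≈-reflexive refl

≈-sym : ∀ {x y} → x ≈ y [mod N ] → y ≈ x [mod N ]
≈-sym {x = x} {y} (mod-∣ d) = mod-∣ (subst (_ ∣ᶻ_) (swap x y) (∣m⇒∣-m d))
  where
  swap : ∀ x y → - (x - y) ≡ y - x
  swap = solve-∀

≈-+ : ∀ {x y x′ y′} → x ≈ y [mod N ] → x′ ≈ y′ [mod N ] → x + x′ ≈ y + y′ [mod N ]
≈-+ {x = x} {y} {x′} {y′} (mod-∣ d) (mod-∣ d′) =
  mod-∣ (subst (_ ∣ᶻ_) (regroup x y x′ y′) (∣m∣n⇒∣m+n d d′))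
  where
  regroup : ∀ x y x′ y′ → (x - y) + (x′ - y′) ≡ (x + x′) - (y + y′)
  regroup = solve-∀

≈-- : ∀ {x y x′ y′} → x ≈ y [mod N ] → x′ ≈ y′ [mod N ] → x - x′ ≈ y - y′ [mod N ]
≈-- {x = x} {y} {x′} {y′} (mod-∣ d) (mod-∣ d′) =
  mod-∣ (subst (_ ∣ᶻ_) (regroup x y x′ y′) (∣m∣n⇒∣m-n d d′))
  where
  regroup : ∀ x y x′ y′ → (x - y) - (x′ - y′) ≡ (x - x′) - (y - y′)
  regroup = solve-∀

≈-· : ∀ k {x y} → x ≈ y [mod N ] → k · x ≈ k · y [mod N ]
≈-· k {x} {y} (mod-∣ d) = mod-∣ (subst (_ ∣ᶻ_) (distrib k x y) (∣n⇒∣m*n k d))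
  where
  distrib : ∀ k x y → k · (x - y) ≡ k · x - k · y
  distrib = solve-∀

≈-trans : ∀ {x y z} → x ≈ y [mod N ] → y ≈ z [mod N ] → x ≈ z [mod N ]
≈-trans {x = x} {y} {z} p q = ≈-by-difference (≈-+ p q) (telescope x y z)
  where
  telescope : ∀ x y z → (x + y) - (y + z) ≡ x - z
  telescope = solve-∀

mod-setoid : ℤ → Setoid 0ℓ 0ℓ
mod-setoid N = record
  { _≈_ = λ x y → x ≈ y [mod N ]
  ; isEquivalence = record { refl = ≈-refl ; sym = ≈-sym ; trans = ≈-trans } }

≈[mod0]⇒≡ : ∀ {x y} → x ≈ y [mod 0ℤ ] → x ≡ y
≈[mod0]⇒≡ {x} {y} (mod-∣ d) = ℤₚ.i-j≡0⇒i≡j x y (0∣⇒≡0 d)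

-- Functions up to constants

-- As congruence modulo 0ℤ is equality, N = 0ℤ stands for honest constants.
record Constant {n : ℕ} (N : ℤ) (u : Fin n → ℤ) : Set where
  constructor constant
  field u≈u : ∀ i j → u i ≈ u j [mod N ]

open Constant

module _ {u v : Fin n → ℤ} where

  Constant-cong : (∀ i → u i ≡ v i) → Constant N u → Constant N v
  Constant-cong u≡v (constant c) = constant λ i j → subst₂ (_≈_[mod _ ]) (u≡v i) (u≡v j) (c i j)

  ≗⇒Constant-difference : (∀ i → u i ≡ v i) → Constant N (λ i → u i - v i)
  ≗⇒Constant-difference u≡v = constant λ i j → ≈-reflexive
    (trans (ℤₚ.i≡j⇒i-j≡0 (u≡v i)) (sym (ℤₚ.i≡j⇒i-j≡0 (u≡v j))))

  infixl 6 _⟨+⟩_ _⟨-⟩_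
  _⟨+⟩_ : Constant N u → Constant N v → Constant N (λ i → u i + v i)
  constant c ⟨+⟩ constant d = constant λ i j → ≈-+ (c i j) (d i j)

  _⟨-⟩_ : Constant N u → Constant N v → Constant N (λ i → u i - v i)
  constant c ⟨-⟩ constant d = constant λ i j → ≈-- (c i j) (d i j)

module _ {u : Fin n → ℤ} where

  Constant-· : ∀ k → Constant N u → Constant N (λ i → k · u i)
  Constant-· k (constant c) = constant λ i j → ≈-· k (c i j)

  Constant-∘ : (g : Fin n → Fin n) → Constant N u → Constant N (u ∘ g)
  Constant-∘ g (constant c) = constant λ i j → c (g i) (g j)

  Constant-multiple : Constant N (λ i → N · u i)
  Constant-multiple {N} = constant λ i j → mod-∣ (dividesᶻ (u i - u j) (distrib N (u i) (u j)))
    where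
    distrib : ∀ N x y → N · x - N · y ≡ (x - y) · N
    distrib = solve-∀

  Constant-mod : Constant 0ℤ u → Constant N u
  Constant-mod (constant c) = constant λ i j → ≈-reflexive (≈[mod0]⇒≡ (c i j))

  Constant-cancel : ∀ k .{{_ : ℤ.NonZero k}} → Constant 0ℤ (λ i → k · u i) → Constant 0ℤ u
  Constant-cancel k (constant c) = constant λ i j →
    ≈-reflexive (ℤₚ.*-cancelˡ-≡ k _ _ (≈[mod0]⇒≡ (c i j)))

Constant-const : (c : ℤ) → Constant {n} N (λ _ → c)
Constant-const c = constant λ _ _ → ≈-refl

Constant-∑ : (xs : List A) {u : A → Fin n → ℤ} → (∀ {x} → x ∈ xs → Constant N (u x)) →
  Constant N (λ i → ∑ xs (λ x → u x i))
Constant-∑ [] c = Constant-const 0ℤ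
Constant-∑ (x ∷ xs) c = c (here refl) ⟨+⟩ Constant-∑ xs (c ∘ there)

-- Cochains on points

PointCochain₁ PointCochain₂ : ℕ → Set
PointCochain₁ n = Perm n → Fin n → ℤ
PointCochain₂ n = Perm n → Perm n → Fin n → ℤ

δ₀ : (Fin n → ℤ) → PointCochain₁ n
δ₀ w a i = w (a ·ₚ i) - w i

-- The inhomogeneous differential for the right action (u · b) i = u (b i) on functions.
δ : PointCochain₁ n → PointCochain₂ n
δ Φ a b i = Φ b i - Φ (a * b) i + Φ a (b ·ₚ i)

record IsCocycle (P : Pred (Perm n) 0ℓ) (F : PointCochain₂ n) : Set where
  constructor isCocycle
  field closed : ∀ {a b c} → P a → P b → P c →
          Constant 0ℤ (λ i → F b c i - F (a * b) c i + F a (b * c) i - F a b (c ·ₚ i))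

record IsPrimitive (P : Pred (Perm n) 0ℓ) (F : PointCochain₂ n) (Φ : PointCochain₁ n) : Set where
  constructor isPrimitive
  field bounds : ∀ {a b} → P a → P b → Constant 0ℤ (λ i → F a b i - δ Φ a b i)

open IsCocycle
open IsPrimitive

IsCoboundary : Pred (Perm n) 0ℓ → PointCochain₂ n → Set
IsCoboundary P F = ∃ (IsPrimitive P F)

infixl 7 _•_
_•_ : ℤ → PointCochain₂ n → PointCochain₂ n
(k • F) a b i = k · F a b i

IsCocycle-⊆ : {P Q : Pred (Perm n) 0ℓ} {F : PointCochain₂ n} →
  (∀ {a} → P a → Q a) → IsCocycle Q F → IsCocycle P F
IsCocycle-⊆ P⊆Q (isCocycle z) = isCocycle λ Pa Pb Pc → z (P⊆Q Pa) (P⊆Q Pb) (P⊆Q Pc)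

IsPrimitive-⊆ : {P Q : Pred (Perm n) 0ℓ} {F : PointCochain₂ n} {Φ : PointCochain₁ n} →
  (∀ {a} → P a → Q a) → IsPrimitive Q F Φ → IsPrimitive P F Φ
IsPrimitive-⊆ P⊆Q (isPrimitive b) = isPrimitive λ Pa Pb → b (P⊆Q Pa) (P⊆Q Pb)

IsPrimitive-combine : {P : Pred (Perm n) 0ℓ} {F F′ F″ : PointCochain₂ n} {Φ Φ′ : PointCochain₁ n}
  (x y : ℤ) → (∀ a b i → x · F a b i + y · F′ a b i ≡ F″ a b i) →
  IsPrimitive P F Φ → IsPrimitive P F′ Φ′ → IsPrimitive P F″ (λ a i → x · Φ a i + y · Φ′ a i)
IsPrimitive-combine {F = F} {F′} {F″} {Φ} {Φ′} x y eq (isPrimitive b) (isPrimitive b′) =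
  isPrimitive λ {a} {c} Pa Pc → Constant-cong
    (λ i → trans
      (regroup x y (F a c i) (F′ a c i) (Φ c i) (Φ (a * c) i) (Φ a (c ·ₚ i))
        (Φ′ c i) (Φ′ (a * c) i) (Φ′ a (c ·ₚ i)))
      (cong (_- δ (λ a i → x · Φ a i + y · Φ′ a i) a c i) (eq a c i)))
    (Constant-· x (b Pa Pc) ⟨+⟩ Constant-· y (b′ Pa Pc))
  where
  regroup : ∀ x y f f′ p q r p′ q′ r′ →
    x · (f - (p - q + r)) + y · (f′ - (p′ - q′ + r′))
    ≡ x · f + y · f′ - (x · p + y · p′ - (x · q + y · q′) + (x · r + y · r′))
  regroup = solve-∀

module _ {P : Pred (Perm n) 0ℓ} {F : PointCochain₂ n} where

  consecutive-multiples-coboundary : ∀ x y {k l} → 1 ℕ.+ y ℕ.* l ≡ x ℕ.* k →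
    IsCoboundary P (ℤ.+ k • F) → IsCoboundary P (ℤ.+ l • F) → IsCoboundary P F
  consecutive-multiples-coboundary x y {k} {l} 1+yl≡xk (_ , Φ-prim) (_ , Ψ-prim) =
    _ , IsPrimitive-combine (ℤ.+ x) (- (ℤ.+ y)) (λ a b i → combination (F a b i)) Φ-prim Ψ-prim
    where
    open ≡-Reasoning
    regroup : ∀ x k y l f → x · (k · f) + - y · (l · f) ≡ (x · k - y · l) · f
    regroup = solve-∀
    cancel : ∀ z f → (1ℤ + z - z) · f ≡ f
    cancel = solve-∀
    combination : ∀ f → ℤ.+ x · (ℤ.+ k · f) + - (ℤ.+ y) · (ℤ.+ l · f) ≡ f
    combination f = begin
      ℤ.+ x · (ℤ.+ k · f) + - (ℤ.+ y) · (ℤ.+ l · f)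
        ≡⟨ regroup (ℤ.+ x) (ℤ.+ k) (ℤ.+ y) (ℤ.+ l) f ⟩
      (ℤ.+ x · ℤ.+ k - ℤ.+ y · ℤ.+ l) · f
        ≡⟨ cong₂ (λ u v → (u - v) · f) (ℤₚ.pos-* x k) (ℤₚ.pos-* y l) ⟨
      (ℤ.+ (x ℕ.* k) - ℤ.+ (y ℕ.* l)) · f
        ≡⟨ cong (λ u → (ℤ.+ u - ℤ.+ (y ℕ.* l)) · f) 1+yl≡xk ⟨
      (1ℤ + ℤ.+ (y ℕ.* l) - ℤ.+ (y ℕ.* l)) · f
        ≡⟨ cancel (ℤ.+ (y ℕ.* l)) f ⟩
      f ∎

  coprime-multiples-coboundary : ∀ {k l} → Coprime k l →
    IsCoboundary P (ℤ.+ k • F) → IsCoboundary P (ℤ.+ l • F) → IsCoboundary P F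
  coprime-multiples-coboundary k⊥l ∃Φ ∃Ψ with coprime-Bézout k⊥l
  ... | Bézout.+- x y eq = consecutive-multiples-coboundary x y eq ∃Φ ∃Ψ
  ... | Bézout.-+ x y eq = consecutive-multiples-coboundary y x eq ∃Ψ ∃Φ

-- Transfer

∑-isPrimitive : (G : Subgroup n) {F : PointCochain₂ n} → IsCocycle (_∈ˢ G) F →
  (T : List (Perm n)) → (∀ {t} → t ∈ T → t ∈ˢ G) →
  (∀ {a b} → a ∈ˢ G → b ∈ˢ G →
     Constant 0ℤ (λ i → ∑ T (λ t → F (t * a) b i) - ∑ T (λ t → F t b i))) →
  IsPrimitive (_∈ˢ G) (ℤ.+ length T • F) (λ b i → ∑ T (λ t → F t b i))
∑-isPrimitive G {F} (isCocycle closed) T T⊆G invariant = isPrimitive λ {a} {b} a∈ b∈ →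
  Constant-cong (total a b)
    (Constant-∑ T (λ t∈ → closed (T⊆G t∈) a∈ b∈) ⟨+⟩ invariant a∈ b∈)
  where
  open ≡-Reasoning
  U : PointCochain₁ _
  U b i = ∑ T (λ t → F t b i)
  regroup : ∀ nf x y z u → nf - x + y - z + (x - u) ≡ nf - (u - y + z)
  regroup = solve-∀
  total : ∀ a b i →
    ∑ T (λ t → F a b i - F (t * a) b i + F t (a * b) i - F t a (b ·ₚ i))
      + (∑ T (λ t → F (t * a) b i) - U b i)
    ≡ ℤ.+ length T · F a b i - δ U a b i
  total a b i = begin
    ∑ T (λ t → F a b i - F (t * a) b i + F t (a * b) i - F t a (b ·ₚ i)) + (Ua - U b i)
      ≡⟨ cong (_+ (Ua - U b i)) (∑-distrib-- _ _ T) ⟩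
    ∑ T (λ t → F a b i - F (t * a) b i + F t (a * b) i) - U a (b ·ₚ i) + (Ua - U b i)
      ≡⟨ cong (λ z → z - U a (b ·ₚ i) + (Ua - U b i)) (∑-distrib-+ _ _ T) ⟩
    ∑ T (λ t → F a b i - F (t * a) b i) + U (a * b) i - U a (b ·ₚ i) + (Ua - U b i)
      ≡⟨ cong (λ z → z + U (a * b) i - U a (b ·ₚ i) + (Ua - U b i)) (∑-distrib-- _ _ T) ⟩
    ∑ T (λ _ → F a b i) - Ua + U (a * b) i - U a (b ·ₚ i) + (Ua - U b i)
      ≡⟨ cong (λ z → z - Ua + U (a * b) i - U a (b ·ₚ i) + (Ua - U b i)) (∑-const (F a b i) T) ⟩
    ℤ.+ length T · F a b i - Ua + U (a * b) i - U a (b ·ₚ i) + (Ua - U b i)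
      ≡⟨ regroup (ℤ.+ length T · F a b i) Ua (U (a * b) i) (U a (b ·ₚ i)) (U b i) ⟩
    ℤ.+ length T · F a b i - δ U a b i ∎
    where
    Ua : ℤ
    Ua = ∑ T (λ t → F (t * a) b i)

order-multiple-coboundary : (G : Subgroup n) {F : PointCochain₂ n} → IsCocycle (_∈ˢ G) F →
  IsCoboundary (_∈ˢ G) (ℤ.+ order G • F)
order-multiple-coboundary G {F} F-cocycle = _ , ∑-isPrimitive G F-cocycle (elems G) id
  λ {a} {b} a∈ _ → ≗⇒Constant-difference λ i → ∑-reindex (_* a) (λ t → F t b i) (right-translate-↭ G a∈)

module Cosets (G S : Subgroup n) (S≤G : S ≤ˢ G) where

  open Orbits S _≟ₚ_ _*_ *-identityˡ *-assoc
  open Representatives ~-decSetoid (elems G)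
    renaming (reps to cosetReps; reps⊆ to cosetReps⊆) public

  order-*-index : order S ℕ.* length cosetReps ≡ order G
  order-*-index = class-equation _*_ (unique S) (unique G)
    (λ s∈ x∈ → mul-closed G (S≤G s∈) x∈ , moved-by s∈ refl)
    (λ x∈ → *-cancelʳ G x∈)
    (λ _ _ (moved-by s∈ eq) → _ , s∈ , eq)

  factor : ∀ {x} → x ∈ˢ G → ∃[ (s , t) ] (s ∈ˢ S × t ∈ cosetReps × s * t ≡ x)
  factor x∈ with t , t∈ , x~t ← represented x∈ with moved-by s∈ eq ← ~-sym x~t =
    (_ , t) , s∈ , t∈ , eq

  factor-unique : ∀ {s t s′ t′} → s ∈ˢ S → t ∈ cosetReps → s′ ∈ˢ S → t′ ∈ cosetReps →
    s * t ≡ s′ * t′ → s ≡ s′ × t ≡ t′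
  factor-unique s∈ t∈ s′∈ t′∈ eq
    with refl ← reps-apart t∈ t′∈ (~-trans (moved-by s∈ eq) (~-sym (moved-by s′∈ refl))) =
    *-cancelʳ G (cosetReps⊆ t∈) eq , refl

  abstract
    factorization : ∃ λ (f : Perm n → Perm n × Perm n) → ∀ {x} → x ∈ˢ G →
      proj₁ (f x) ∈ˢ S × proj₂ (f x) ∈ cosetReps × proj₁ (f x) * proj₂ (f x) ≡ x
    factorization = choose G (idP , idP) factor

  head rep : Perm n → Perm n
  head x = proj₁ (proj₁ factorization x)
  rep x = proj₂ (proj₁ factorization x)

  module _ {x : Perm n} (x∈ : x ∈ˢ G) where

    head∈ : head x ∈ˢ S
    head∈ = proj₁ (proj₂ factorization x∈)

    rep∈ : rep x ∈ cosetReps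
    rep∈ = proj₁ (proj₂ (proj₂ factorization x∈))

    head*rep≡ : head x * rep x ≡ x
    head*rep≡ = proj₂ (proj₂ (proj₂ factorization x∈))

  translate-↭ : ∀ {b} → b ∈ˢ G → map (λ t → rep (t * b)) cosetReps ↭ cosetReps
  translate-↭ {b} b∈ = bijection⇒↭ (λ t → rep (t * b)) reps-unique reps-unique
    (λ t∈ → rep∈ (tb∈ t∈)) inj onto
    where
    tb∈ : ∀ {t} → t ∈ cosetReps → (t * b) ∈ˢ G
    tb∈ t∈ = mul-closed G (cosetReps⊆ t∈) b∈
    rep-~ : ∀ {x} → x ∈ˢ G → rep x ~ x
    rep-~ x∈ = moved-by (head∈ x∈) (head*rep≡ x∈)
    *ʳ-~ : ∀ {x y} c → x ~ y → (x * c) ~ (y * c)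
    *ʳ-~ {x} c (moved-by {s} s∈ refl) = moved-by s∈ (sym (*-assoc s x c))
    inj : ∀ {s t} → s ∈ cosetReps → t ∈ cosetReps → rep (s * b) ≡ rep (t * b) → s ≡ t
    inj {s} {t} s∈ t∈ eq = reps-apart s∈ t∈ (subst₂ _~_ ([ba]a⁻¹≡b G b∈ s) ([ba]a⁻¹≡b G b∈ t)
      (*ʳ-~ (b ⁻¹) (~-trans (~-sym (rep-~ (tb∈ s∈))) (subst (_~ (t * b)) (sym eq) (rep-~ (tb∈ t∈))))))
    onto : ∀ {t} → t ∈ cosetReps → ∃[ s ] (s ∈ cosetReps × rep (s * b) ≡ t)
    onto {t} t∈ = s , rep∈ tb⁻¹∈ , reps-apart (rep∈ (tb∈ (rep∈ tb⁻¹∈))) t∈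
      (~-trans (rep-~ (tb∈ (rep∈ tb⁻¹∈)))
        (subst ((s * b) ~_) ([ba⁻¹]a≡b G b∈ t) (*ʳ-~ b (rep-~ tb⁻¹∈))))
      where
      s : Perm n
      s = rep (t * b ⁻¹)
      tb⁻¹∈ : (t * b ⁻¹) ∈ˢ G
      tb⁻¹∈ = mul-closed G (cosetReps⊆ t∈) (⁻¹-closed G b∈)

δ-isCocycle : (P : Pred (Perm n) 0ℓ) (Φ : PointCochain₁ n) → IsCocycle P (δ Φ)
δ-isCocycle P Φ = isCocycle λ {a} {b} {c} _ _ _ →
  Constant-cong (λ i → sym (vanishes a b c i)) (Constant-const 0ℤ)
  where
  open ≡-Reasoning
  cancel : ∀ c bc b abc ab a →
    (c - bc + b) - (c - abc + ab) + (bc - abc + a) - (b - ab + a) ≡ 0ℤ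
  cancel = solve-∀
  vanishes : ∀ a b c i → δ Φ b c i - δ Φ (a * b) c i + δ Φ a (b * c) i - δ Φ a b (c ·ₚ i) ≡ 0ℤ
  vanishes a b c i = begin
    δ Φ b c i - δ Φ (a * b) c i + δ Φ a (b * c) i - δ Φ a b (c ·ₚ i)
      ≡⟨ cong₂ (λ x j → δ Φ b c i - (Φ c i - Φ x i + Φ (a * b) (c ·ₚ i))
                 + (Φ (b * c) i - Φ (a * (b * c)) i + Φ a j) - δ Φ a b (c ·ₚ i))
           (*-assoc a b c) (*-act b c i) ⟩
    δ Φ b c i - (Φ c i - Φ (a * (b * c)) i + Φ (a * b) (c ·ₚ i))
      + (Φ (b * c) i - Φ (a * (b * c)) i + Φ a (b ·ₚ (c ·ₚ i))) - δ Φ a b (c ·ₚ i)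
      ≡⟨ cancel (Φ c i) (Φ (b * c) i) (Φ b (c ·ₚ i)) (Φ (a * (b * c)) i) (Φ (a * b) (c ·ₚ i))
           (Φ a (b ·ₚ (c ·ₚ i))) ⟩
    0ℤ ∎

δ-isPrimitive : (P : Pred (Perm n) 0ℓ) (Φ : PointCochain₁ n) → IsPrimitive P (δ Φ) Φ
δ-isPrimitive P Φ = isPrimitive λ {a} {b} _ _ → ≗⇒Constant-difference {u = δ Φ a b} λ _ → refl

infixl 6 _⊝_
_⊝_ : PointCochain₂ n → PointCochain₂ n → PointCochain₂ n
(F ⊝ F′) a b i = F a b i - F′ a b i

IsCocycle-- : {P : Pred (Perm n) 0ℓ} {F F′ : PointCochain₂ n} →
  IsCocycle P F → IsCocycle P F′ → IsCocycle P (F ⊝ F′)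
IsCocycle-- {F = F} {F′} (isCocycle z) (isCocycle z′) = isCocycle λ {a} {b} {c} Pa Pb Pc →
  Constant-cong
    (λ i → regroup (F b c i) (F (a * b) c i) (F a (b * c) i) (F a b (c ·ₚ i))
      (F′ b c i) (F′ (a * b) c i) (F′ a (b * c) i) (F′ a b (c ·ₚ i)))
    (z Pa Pb Pc ⟨-⟩ z′ Pa Pb Pc)
  where
  regroup : ∀ x y z w x′ y′ z′ w′ → (x - y + z - w) - (x′ - y′ + z′ - w′)
    ≡ (x - x′) - (y - y′) + (z - z′) - (w - w′)
  regroup = solve-∀

cohomologous-coboundary : {P : Pred (Perm n) 0ℓ} (k : ℤ) (F : PointCochain₂ n) (h : PointCochain₁ n) →
  IsCoboundary P (k • (F ⊝ δ h)) → IsCoboundary P (k • F)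
cohomologous-coboundary {P = P} k F h (Ψ , Ψ-prim) = _ , IsPrimitive-combine
  {F = k • (F ⊝ δ h)} {δ h} 1ℤ k (λ a b i → recombine k (F a b i) (δ h a b i))
  Ψ-prim (δ-isPrimitive P h)
  where
  recombine : ∀ k f d → 1ℤ · (k · (f - d)) + k · d ≡ k · f
  recombine = solve-∀

module _ (G S : Subgroup n) (S≤G : S ≤ˢ G)
  {F : PointCochain₂ n} (F-cocycle : IsCocycle (_∈ˢ G) F) where

  open Cosets G S S≤G

  -- F = δ h on S × G, except that Φ s stands in for h s.
  Extends : PointCochain₁ n → PointCochain₁ n → Set
  Extends h Φ = ∀ {s x} → s ∈ˢ S → x ∈ˢ G →
    Constant 0ℤ (λ i → F s x i - (h x i - h (s * x) i + Φ s (x ·ₚ i)))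

  -- With t representing the coset of x = s t, the cocycle identity for (s′ , s , t) dictates
  -- h x = Φ s · t - F s t.
  primitive-extends : {Φ : PointCochain₁ n} → IsPrimitive (_∈ˢ S) F Φ → ∃[ h ] Extends h Φ
  primitive-extends {Φ} Φ-prim = h , λ {s} s∈ x∈ → subst
    (λ x → Constant 0ℤ (λ i → F s x i - (h x i - h (s * x) i + Φ s (x ·ₚ i))))
    (head*rep≡ x∈) (extends s∈ (head∈ x∈) (rep∈ x∈))
    where
    value : Perm n → Perm n → Fin n → ℤ
    value s t i = Φ s (t ·ₚ i) - F s t i
    h : PointCochain₁ n
    h x = value (head x) (rep x)
    h-* : ∀ {s t} → s ∈ˢ S → t ∈ cosetReps → h (s * t) ≡ value s t
    h-* {s} {t} s∈ t∈ =
      let st∈ = mul-closed G (S≤G s∈) (cosetReps⊆ t∈)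
          (s≡ , t≡) = factor-unique (head∈ st∈) (rep∈ st∈) s∈ t∈ (head*rep≡ st∈)
      in cong₂ value s≡ t≡
    extends : ∀ {s s′ t} → s ∈ˢ S → s′ ∈ˢ S → t ∈ cosetReps →
      Constant 0ℤ (λ i → F s (s′ * t) i - (h (s′ * t) i - h (s * (s′ * t)) i + Φ s ((s′ * t) ·ₚ i)))
    extends {s} {s′} {t} s∈ s′∈ t∈ = Constant-cong
      (λ i → begin
        (F s′ t i - F (s * s′) t i + F s (s′ * t) i - F s s′ (t ·ₚ i))
          + (F s s′ (t ·ₚ i) - δ Φ s s′ (t ·ₚ i))
          ≡⟨ regroup (F s′ t i) (F (s * s′) t i) (F s (s′ * t) i) (F s s′ (t ·ₚ i))
               (Φ s′ (t ·ₚ i)) (Φ (s * s′) (t ·ₚ i)) (Φ s (s′ ·ₚ (t ·ₚ i))) ⟩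
        F s (s′ * t) i - (value s′ t i - value (s * s′) t i + Φ s (s′ ·ₚ (t ·ₚ i)))
          ≡⟨ cong (λ z → F s (s′ * t) i - (z + Φ s (s′ ·ₚ (t ·ₚ i))))
               (cong₂ (λ u v → u i - v i) (h-* s′∈ t∈)
                 (trans (cong h (sym (*-assoc s s′ t))) (h-* (mul-closed S s∈ s′∈) t∈))) ⟨
        F s (s′ * t) i - (h (s′ * t) i - h (s * (s′ * t)) i + Φ s (s′ ·ₚ (t ·ₚ i)))
          ≡⟨ cong (λ j → F s (s′ * t) i - (h (s′ * t) i - h (s * (s′ * t)) i + Φ s j))
               (*-act s′ t i) ⟨
        F s (s′ * t) i - (h (s′ * t) i - h (s * (s′ * t)) i + Φ s ((s′ * t) ·ₚ i)) ∎)
      (closed F-cocycle (S≤G s∈) (S≤G s′∈) (cosetReps⊆ t∈)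
        ⟨+⟩ Constant-∘ (t ·ₚ_) (bounds Φ-prim s∈ s′∈))
      where
      open ≡-Reasoning
      regroup : ∀ f f′ g e p p′ q → (f - f′ + g - e) + (e - (p - p′ + q))
        ≡ g - ((p - f) - (p′ - f′) + q)
      regroup = solve-∀

  LeftInvariant : PointCochain₂ n → Set
  LeftInvariant F′ = ∀ {s x b} → s ∈ˢ S → x ∈ˢ G → b ∈ˢ G →
    Constant 0ℤ (λ i → F′ (s * x) b i - F′ x b i)

  extends⇒left-invariant : (h Φ : PointCochain₁ n) → Extends h Φ → LeftInvariant (F ⊝ δ h)
  extends⇒left-invariant h Φ extends {s} {x} {b} s∈ x∈ b∈ = Constant-cong
    (λ i → trans
      (cong₂ (λ y j → F s (x * b) i - (h (x * b) i - h y i + Φ s j)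
               - (F s x (b ·ₚ i) - (h x (b ·ₚ i) - h (s * x) (b ·ₚ i) + Φ s (x ·ₚ (b ·ₚ i))))
               - (F x b i - F (s * x) b i + F s (x * b) i - F s x (b ·ₚ i)))
             (sym (*-assoc s x b)) (*-act x b i))
      (regroup (F s (x * b) i) (h (x * b) i) (h ((s * x) * b) i) (Φ s (x ·ₚ (b ·ₚ i)))
        (F s x (b ·ₚ i)) (h x (b ·ₚ i)) (h (s * x) (b ·ₚ i)) (F x b i) (F (s * x) b i) (h b i)))
    (extends s∈ (mul-closed G x∈ b∈) ⟨-⟩ Constant-∘ (b ·ₚ_) (extends s∈ x∈)
      ⟨-⟩ closed F-cocycle (S≤G s∈) x∈ b∈)
    where
    regroup : ∀ f hxb hsxb p g hx hsx e e′ hb →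
      f - (hxb - hsxb + p) - (g - (hx - hsx + p)) - (e - e′ + f - g)
      ≡ (e′ - (hb - hsxb + hsx)) - (e - (hb - hxb + hx))
    regroup = solve-∀

  left-invariant⇒∑-invariant : {F′ : PointCochain₂ n} → LeftInvariant F′ →
    ∀ {a b} → a ∈ˢ G → b ∈ˢ G →
    Constant 0ℤ (λ i → ∑ cosetReps (λ t → F′ (t * a) b i) - ∑ cosetReps (λ t → F′ t b i))
  left-invariant⇒∑-invariant {F′} invariant {a} {b} a∈ b∈ = Constant-cong
    (λ i → trans (∑-distrib-- _ _ cosetReps)
      (cong (λ z → ∑ cosetReps (λ t → F′ (t * a) b i) - z)
        (∑-reindex (λ t → rep (t * a)) (λ t → F′ t b i) (translate-↭ a∈))))
    (Constant-∑ cosetReps term)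
    where
    term : ∀ {t} → t ∈ cosetReps → Constant 0ℤ (λ i → F′ (t * a) b i - F′ (rep (t * a)) b i)
    term {t} t∈ = subst (λ x → Constant 0ℤ (λ i → F′ x b i - F′ (rep (t * a)) b i)) (head*rep≡ ta∈)
      (invariant (head∈ ta∈) (cosetReps⊆ (rep∈ ta∈)) b∈)
      where
      ta∈ : (t * a) ∈ˢ G
      ta∈ = mul-closed G (cosetReps⊆ t∈) a∈

  transfer : IsCoboundary (_∈ˢ S) F → IsCoboundary (_∈ˢ G) (ℤ.+ length cosetReps • F)
  transfer (Φ , Φ-prim) = let (h , extends) = primitive-extends Φ-prim in
    cohomologous-coboundary (ℤ.+ length cosetReps) F h
      (_ , ∑-isPrimitive G (IsCocycle-- F-cocycle (δ-isCocycle (_∈ˢ G) h)) cosetReps cosetReps⊆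
        (left-invariant⇒∑-invariant {F ⊝ δ h} (extends⇒left-invariant h Φ extends)))

-- Cochains with values in J as cochains on points

module Points (G H : Subgroup n) (transitive : IsTransitive G)
  (i₀ : Fin n) (H-stabilizes : IsPointStabilizer G H i₀) where

  γ : Fin n → Perm n
  γ j = proj₁ (transitive j i₀)

  γ∈ : ∀ j → γ j ∈ˢ G
  γ∈ j = proj₁ (proj₂ (transitive j i₀))

  γ-act : ∀ j → γ j ·ₚ j ≡ i₀
  γ-act j = proj₂ (proj₂ (transitive j i₀))

  eval : Cochain n → Fin n → ℤ
  eval x j = x (γ j)

  ind-value : ∀ {x} → IsInd G H x → ∀ {z j} → z ∈ˢ G → z ·ₚ j ≡ i₀ → x z ≡ eval x j
  ind-value {x} ind {z} {j} z∈ zj≡i₀ =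
    trans (cong x (sym ([ba⁻¹]a≡b G (γ∈ j) z))) (ind h∈ (γ∈ j))
    where
    h∈ : (z * γ j ⁻¹) ∈ˢ H
    h∈ = Equivalence.from (H-stabilizes _) (mul-closed G z∈ (⁻¹-closed G (γ∈ j)) ,
      trans (*-act z (γ j ⁻¹) i₀) (trans (cong (z ·ₚ_) (act≡⇒⁻¹-act≡ G (γ∈ j) (γ-act j))) zj≡i₀))

  ind-value-translate : ∀ {x} → IsInd G H x → ∀ {a} → a ∈ˢ G → ∀ j →
    x (γ (a ·ₚ j) * a) ≡ eval x j
  ind-value-translate ind {a} a∈ j = ind-value ind (mul-closed G (γ∈ _) a∈)
    (trans (*-act (γ (a ·ₚ j)) a j) (γ-act (a ·ₚ j)))

  ≈J⇒Constant : ∀ {x} y → x ≈J[ G ] y → (z : Fin n → Perm n) → (∀ i → z i ∈ˢ G) →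
    Constant 0ℤ (λ i → x (z i) - y (z i))
  ≈J⇒Constant {x} y (c , x≡y+c) z z∈ = Constant-cong (λ i → sym (difference i)) (Constant-const c)
    where
    cancel : ∀ u c → u + c - u ≡ c
    cancel = solve-∀
    difference : ∀ i → x (z i) - y (z i) ≡ c
    difference i = trans (cong (_- y (z i)) (x≡y+c (z∈ i))) (cancel (y (z i)) c)

  -- Evaluating at points already moved by the group elements turns the left action on
  -- cochains into precomposition from the right, so that no inverses occur.
  toPoints₁ : (Perm n → Cochain n) → PointCochain₁ n
  toPoints₁ φ a i = eval (φ a) (a ·ₚ i)

  toPoints₂ : Cochain2 n → PointCochain₂ n
  toPoints₂ f a b i = eval (f a b) (a ·ₚ (b ·ₚ i))

  toPoints-cocycle : ∀ {f} → Is2Cocycle G H f → IsCocycle (_∈ˢ G) (toPoints₂ f)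
  toPoints-cocycle {f} (f-ind , f-cocycle) = isCocycle λ {a} {b} {c} a∈ b∈ c∈ →
    let z = λ i → γ (a ·ₚ (b ·ₚ (c ·ₚ i))) in
    Constant-cong (λ i → begin
      f b c (z i * a) - f (a * b) c (z i) + f a (b * c) (z i) - f a b (z i) - 0ℤ
        ≡⟨ ℤₚ.+-identityʳ _ ⟩
      f b c (z i * a) - f (a * b) c (z i) + f a (b * c) (z i) - f a b (z i)
        ≡⟨ cong (λ u → u - f (a * b) c (z i) + f a (b * c) (z i) - f a b (z i))
             (ind-value-translate (f-ind b∈ c∈) a∈ (b ·ₚ (c ·ₚ i))) ⟩
      toPoints₂ f b c i - f (a * b) c (z i) + f a (b * c) (z i) - f a b (z i)
        ≡⟨ cong₂ (λ j k → toPoints₂ f b c i - eval (f (a * b) c) j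
                            + eval (f a (b * c)) k - f a b (z i))
             (*-act a b (c ·ₚ i)) (cong (a ·ₚ_) (*-act b c i)) ⟨
      toPoints₂ f b c i - toPoints₂ f (a * b) c i + toPoints₂ f a (b * c) i
        - toPoints₂ f a b (c ·ₚ i) ∎)
      (≈J⇒Constant zeroJ (f-cocycle a∈ b∈ c∈) z (λ _ → γ∈ _))
    where open ≡-Reasoning

  toPoints-coboundary : ∀ K {f} → K ≤ˢ G → IsCoboundaryOn G H K f →
    IsCoboundary (_∈ˢ K) (toPoints₂ f)
  toPoints-coboundary K {f} K≤G (φ , φ-ind , φ-cob) = toPoints₁ φ , isPrimitive λ {a} {b} a∈ b∈ →
    let z = λ i → γ (a ·ₚ (b ·ₚ i)) in
    Constant-cong (λ i → begin
      f a b (z i) - (φ b (z i * a) - φ (a * b) (z i) + φ a (z i))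
        ≡⟨ cong₂ (λ u j → f a b (z i) - (u - eval (φ (a * b)) j + φ a (z i)))
             (ind-value-translate (φ-ind b∈) (K≤G a∈) (b ·ₚ i)) (sym (*-act a b i)) ⟩
      toPoints₂ f a b i - δ (toPoints₁ φ) a b i ∎)
      (≈J⇒Constant ((act a (φ b) ⊖ φ (a * b)) ⊕ φ a) (φ-cob a∈ b∈) z (λ _ → γ∈ _))
    where open ≡-Reasoning

  fromPoints-coboundary : ∀ {f} → (∀ {a b} → a ∈ˢ G → b ∈ˢ G → IsInd G H (f a b)) →
    IsCoboundary (_∈ˢ G) (toPoints₂ f) → IsCoboundaryOn G H G f
  fromPoints-coboundary {f} f-ind (Φ , Φ-prim) = φ , φ-ind , φ-cob
    where
    φ : Perm n → Cochain n
    φ a z = Φ a ((z * a) ⁻¹ ·ₚ i₀)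
    φ-ind : ∀ {a} → a ∈ˢ G → IsInd G H (φ a)
    φ-ind {a} a∈ {h} {z} h∈ z∈ = cong (Φ a) (act≡⇒⁻¹-act≡ G hza∈ (begin
      ((h * z) * a) ·ₚ j   ≡⟨ cong (_·ₚ j) (*-assoc h z a) ⟩
      (h * (z * a)) ·ₚ j   ≡⟨ *-act h (z * a) j ⟩
      h ·ₚ ((z * a) ·ₚ j)  ≡⟨ cong (h ·ₚ_) (act-⁻¹ G (mul-closed G z∈ a∈) i₀) ⟩
      h ·ₚ i₀              ≡⟨ proj₂ (Equivalence.to (H-stabilizes h) h∈) ⟩
      i₀                   ∎))
      where
      open ≡-Reasoning
      h∈G : h ∈ˢ G
      h∈G = proj₁ (Equivalence.to (H-stabilizes h) h∈)
      hza∈ : ((h * z) * a) ∈ˢ G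
      hza∈ = mul-closed G (mul-closed G h∈G z∈) a∈
      j : Fin n
      j = (z * a) ⁻¹ ·ₚ i₀
    φ-cob : ∀ {a b} → a ∈ˢ G → b ∈ˢ G → f a b ≈J[ G ] ((act a (φ b) ⊖ φ (a * b)) ⊕ φ a)
    φ-cob {a} {b} a∈ b∈ = c , value
      where
      open ≡-Reasoning
      c : ℤ
      c = toPoints₂ f a b i₀ - δ Φ a b i₀
      rearrange : ∀ x y → x ≡ y + (x - y)
      rearrange = solve-∀
      value : ∀ {z} → z ∈ˢ G → f a b z ≡ φ b (z * a) - φ (a * b) z + φ a z + c
      value {z} z∈ = begin
        f a b z
          ≡⟨ ind-value (f-ind a∈ b∈) z∈ zabj≡i₀ ⟩
        toPoints₂ f a b j
          ≡⟨ rearrange (toPoints₂ f a b j) (δ Φ a b j) ⟩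
        δ Φ a b j + (toPoints₂ f a b j - δ Φ a b j)
          ≡⟨ cong (δ Φ a b j +_) (≈[mod0]⇒≡ (u≈u (bounds Φ-prim a∈ b∈) j i₀)) ⟩
        δ Φ a b j + c
          ≡⟨ cong₂ (λ k l → Φ b k - Φ (a * b) j + Φ a l + c)
               (cong (λ y → y ⁻¹ ·ₚ i₀) (*-assoc z a b))
               (act≡⇒⁻¹-act≡ G (mul-closed G z∈ a∈) (trans (*-act z a _) zabj≡i₀)) ⟨
        φ b (z * a) - φ (a * b) z + φ a z + c ∎
        where
        zab∈ : (z * (a * b)) ∈ˢ G
        zab∈ = mul-closed G z∈ (mul-closed G a∈ b∈)
        j : Fin n
        j = (z * (a * b)) ⁻¹ ·ₚ i₀
        zabj≡i₀ : z ·ₚ (a ·ₚ (b ·ₚ j)) ≡ i₀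
        zabj≡i₀ = begin
          z ·ₚ (a ·ₚ (b ·ₚ j))  ≡⟨ cong (z ·ₚ_) (*-act a b j) ⟨
          z ·ₚ ((a * b) ·ₚ j)   ≡⟨ *-act z (a * b) j ⟨
          (z * (a * b)) ·ₚ j    ≡⟨ act-⁻¹ G zab∈ i₀ ⟩
          i₀                    ∎

-- Crossed homomorphisms

record IsCrossedHom (N : ℤ) (P : Pred (Perm n) 0ℓ) (σ : PointCochain₁ n) : Set where
  constructor isCrossedHom
  field homo : ∀ {a b} → P a → P b → ∀ i → σ (a * b) i ≈ σ a (b ·ₚ i) + σ b i [mod N ]

-- A crossed homomorphism up to constants; the constants δ V a b define a central extension.
record IsProjectiveHom (N : ℤ) (P : Pred (Perm n) 0ℓ) (V : PointCochain₁ n) : Set where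
  constructor isProjectiveHom
  field defect-constant : ∀ {a b} → P a → P b → Constant N (δ V a b)

open IsCrossedHom
open IsProjectiveHom

VanishesOnFixedPoints AgreesOnFixedPoints : ℤ → Pred (Perm n) 0ℓ → PointCochain₁ n → Set
VanishesOnFixedPoints N P σ = ∀ {a i} → P a → a ·ₚ i ≡ i → σ a i ≈ 0ℤ [mod N ]
AgreesOnFixedPoints N P V = ∀ {a i j} → P a → a ·ₚ i ≡ i → a ·ₚ j ≡ j → V a i ≈ V a j [mod N ]

SplitsBy : ℤ → Pred (Perm n) 0ℓ → PointCochain₁ n → (Fin n → ℤ) → Set
SplitsBy N P V w = ∀ {a} → P a → Constant N (λ i → V a i - δ₀ w a i)

module _ (K : Subgroup n) {N : ℤ} {σ : PointCochain₁ n}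
  (σ-hom : IsCrossedHom N (_∈ˢ K) σ) (σ-fix : VanishesOnFixedPoints N (_∈ˢ K) σ) where

  crossedHom-cong : ∀ {a b i} → a ∈ˢ K → b ∈ˢ K → a ·ₚ i ≡ b ·ₚ i → σ a i ≈ σ b i [mod N ]
  crossedHom-cong {a} {b} {i} a∈ b∈ ai≡bi = begin
    σ a i                       ≡⟨ cong (λ c → σ c i) (a[a⁻¹b]≡b K b∈ a) ⟨
    σ (b * c) i                 ≈⟨ homo σ-hom b∈ c∈ i ⟩
    σ b (c ·ₚ i) + σ c i        ≡⟨ cong (λ j → σ b j + σ c i) c-fix ⟩
    σ b i + σ c i               ≈⟨ ≈-+ (≈-refl {x = σ b i}) (σ-fix c∈ c-fix) ⟩
    σ b i + 0ℤ                  ≡⟨ ℤₚ.+-identityʳ (σ b i) ⟩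
    σ b i                       ∎
    where
    open ≈-Reasoning (mod-setoid N)
    c : Perm n
    c = b ⁻¹ * a
    c∈ : c ∈ˢ K
    c∈ = mul-closed K (⁻¹-closed K b∈) a∈
    c-fix : c ·ₚ i ≡ i
    c-fix = ⁻¹*-fix K b∈ a ai≡bi

  crossedHom-principal : ∃[ w ] (∀ {a} → a ∈ˢ K → ∀ i → σ a i ≈ δ₀ w a i [mod N ])
  crossedHom-principal = w , principal
    where
    open Orbits K Finₚ._≟_ _·ₚ_ idP-act *-act
    open Representatives ~-decSetoid (allFin n)
    ρ : Fin n → Fin n
    ρ i = proj₁ (represented (∈-allFin i))
    ρ-reached : ∀ i → i ~ ρ i
    ρ-reached i = proj₂ (proj₂ (represented (∈-allFin i)))
    ρ-act : ∀ {a} → a ∈ˢ K → ∀ i → ρ (a ·ₚ i) ≡ ρ i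
    ρ-act {a} a∈ i = reps-apart (proj₁ (proj₂ (represented (∈-allFin (a ·ₚ i)))))
      (proj₁ (proj₂ (represented (∈-allFin i))))
      (~-trans (~-sym (ρ-reached (a ·ₚ i))) (~-trans (~-sym (moved-by a∈ refl)) (ρ-reached i)))
    from-ρ : ∀ i → ∃[ s ] (s ∈ˢ K × s ·ₚ ρ i ≡ i)
    from-ρ i with moved-by s∈ eq ← ~-sym (ρ-reached i) = _ , s∈ , eq
    s : Fin n → Perm n
    s i = proj₁ (from-ρ i)
    s∈ : ∀ i → s i ∈ˢ K
    s∈ i = proj₁ (proj₂ (from-ρ i))
    s-act : ∀ i → s i ·ₚ ρ i ≡ i
    s-act i = proj₂ (proj₂ (from-ρ i))
    w : Fin n → ℤ
    w i = σ (s i) (ρ i)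
    principal : ∀ {a} → a ∈ˢ K → ∀ i → σ a i ≈ δ₀ w a i [mod N ]
    principal {a} a∈ i = begin
      σ a i                           ≡⟨ add-subtract (σ a i) (w i) ⟩
      σ a i + w i - w i               ≡⟨ cong (λ j → σ a j + w i - w i) (s-act i) ⟨
      σ a (s i ·ₚ ρ i) + w i - w i    ≈⟨ ≈-- (homo σ-hom a∈ (s∈ i) (ρ i)) ≈-refl ⟨
      σ (a * s i) (ρ i) - w i         ≈⟨ ≈-- (crossedHom-cong (s∈ ai) as∈ same-image) ≈-refl ⟨
      σ (s ai) (ρ i) - w i            ≡⟨ cong (λ j → σ (s ai) j - w i) (ρ-act a∈ i) ⟨
      w ai - w i                      ∎
      where
      open ≈-Reasoning (mod-setoid N)
      add-subtract : ∀ x y → x ≡ x + y - y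
      add-subtract = solve-∀
      ai : Fin n
      ai = a ·ₚ i
      as∈ : (a * s i) ∈ˢ K
      as∈ = mul-closed K a∈ (s∈ i)
      same-image : s ai ·ₚ ρ i ≡ (a * s i) ·ₚ ρ i
      same-image = trans (cong (s ai ·ₚ_) (sym (ρ-act a∈ i)))
        (trans (s-act ai) (sym (trans (*-act a (s i) (ρ i)) (cong (a ·ₚ_) (s-act i)))))

primitive⇒projectiveHom : {P : Pred (Perm n) 0ℓ} (N : ℤ) {F : PointCochain₂ n} {V : PointCochain₁ n} →
  IsPrimitive P (N • F) V → IsProjectiveHom N P V
primitive⇒projectiveHom N {F} {V} V-prim = isProjectiveHom λ {a} {b} Pa Pb → Constant-cong
  (λ i → subtract-difference (N · F a b i) (δ V a b i))
  (Constant-multiple {u = F a b} ⟨-⟩ Constant-mod (bounds V-prim Pa Pb))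
  where
  subtract-difference : ∀ x y → x - (x - y) ≡ y
  subtract-difference = solve-∀

IsPrimitive-δ₀ : {P : Pred (Perm n) 0ℓ} {F : PointCochain₂ n} {V : PointCochain₁ n}
  (w : Fin n → ℤ) →
  IsPrimitive P F V → IsPrimitive P F (λ a i → V a i - δ₀ w a i)
IsPrimitive-δ₀ {F = F} {V} w V-prim = isPrimitive λ {a} {b} Pa Pb → Constant-cong
  (λ i → trans
    (regroup (F a b i) (V b i) (V (a * b) i) (V a (b ·ₚ i)) (w i) (w (b ·ₚ i)) (w (a ·ₚ (b ·ₚ i))))
    (cong (λ j → F a b i - ((V b i - δ₀ w b i) - (V (a * b) i - (w j - w i))
                   + (V a (b ·ₚ i) - δ₀ w a (b ·ₚ i))))
      (sym (*-act a b i))))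
  (bounds V-prim Pa Pb)
  where
  regroup : ∀ f p q r wi wb wab → f - (p - q + r)
    ≡ f - ((p - (wb - wi)) - (q - (wab - wi)) + (r - (wab - wb)))
  regroup = solve-∀

module _ (K : Subgroup n) (N : ℤ) .{{_ : ℤ.NonZero N}} {F : PointCochain₂ n} {V : PointCochain₁ n}
  (i₀ : Fin n) where

  constant-primitive⇒coboundary : IsPrimitive (_∈ˢ K) (N • F) V →
    (∀ {a} → a ∈ˢ K → Constant N (V a)) → IsCoboundary (_∈ˢ K) F
  constant-primitive⇒coboundary V-prim V-constant = Φ , isPrimitive λ {a} {b} a∈ b∈ →
    Constant-cancel N (Constant-cong
      (λ i → sym (multiple a∈ b∈ i))
      (bounds V-prim a∈ b∈ ⟨+⟩ Constant-const (V b i₀ - V (a * b) i₀ + V a i₀)))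
    where
    open ≡-Reasoning
    quotients : ∃ λ (Φ : PointCochain₁ n) → ∀ {a} → a ∈ˢ K → ∀ i → V a i - V a i₀ ≡ Φ a i · N
    quotients = choose K {P = λ a φ → ∀ i → V a i - V a i₀ ≡ φ i · N} (λ _ → 0ℤ) λ a∈ →
      let N∣ = λ i → N∣x-y (u≈u (V-constant a∈) i i₀)
      in (λ i → _∣ᶻ_.quotient (N∣ i)) , (λ i → _∣ᶻ_.equality (N∣ i))
    Φ : PointCochain₁ n
    Φ = proj₁ quotients
    Φ·N≡ : ∀ {a} → a ∈ˢ K → ∀ i → Φ a i · N ≡ V a i - V a i₀
    Φ·N≡ a∈ i = sym (proj₂ quotients a∈ i)
    distrib : ∀ m f p q r → m · (f - (p - q + r)) ≡ m · f - (p · m - q · m + r · m)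
    distrib = solve-∀
    regroup : ∀ f p q r p₀ q₀ r₀ →
      f - (p - p₀ - (q - q₀) + (r - r₀)) ≡ f - (p - q + r) + (p₀ - q₀ + r₀)
    regroup = solve-∀
    multiple : ∀ {a b} → a ∈ˢ K → b ∈ˢ K → ∀ i → N · (F a b i - δ Φ a b i)
      ≡ N · F a b i - δ V a b i + (V b i₀ - V (a * b) i₀ + V a i₀)
    multiple {a} {b} a∈ b∈ i = begin
      N · (F a b i - δ Φ a b i)
        ≡⟨ distrib N (F a b i) (Φ b i) (Φ (a * b) i) (Φ a (b ·ₚ i)) ⟩
      N · F a b i - (Φ b i · N - Φ (a * b) i · N + Φ a (b ·ₚ i) · N)
        ≡⟨ cong (λ z → N · F a b i - z)
             (cong₂ _+_ (cong₂ _-_ (Φ·N≡ b∈ i) (Φ·N≡ (mul-closed K a∈ b∈) i)) (Φ·N≡ a∈ (b ·ₚ i))) ⟩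
      N · F a b i - (V b i - V b i₀ - (V (a * b) i - V (a * b) i₀) + (V a (b ·ₚ i) - V a i₀))
        ≡⟨ regroup (N · F a b i) (V b i) (V (a * b) i) (V a (b ·ₚ i))
             (V b i₀) (V (a * b) i₀) (V a i₀) ⟩
      N · F a b i - δ V a b i + (V b i₀ - V (a * b) i₀ + V a i₀) ∎

splits⇒coboundary : (K : Subgroup n) (N : ℤ) .{{_ : ℤ.NonZero N}} {F : PointCochain₂ n}
  {V : PointCochain₁ n} → Fin n →
  IsPrimitive (_∈ˢ K) (N • F) V → ∃ (SplitsBy N (_∈ˢ K) V) → IsCoboundary (_∈ˢ K) F
splits⇒coboundary K N {F} i₀ V-prim (w , V-splits) =
  constant-primitive⇒coboundary K N {F} i₀ (IsPrimitive-δ₀ w V-prim) V-splits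

-- Coboundaries on cyclic subgroups

Powers : Perm n → Pred (Perm n) 0ℓ
Powers a b = ∃[ k ] (b ≡ a ^ₚ k)

primitive-difference : {P : Pred (Perm n) 0ℓ} (N : ℤ) {F : PointCochain₂ n} {V Φ : PointCochain₁ n} →
  IsPrimitive P (N • F) V → IsPrimitive P F Φ → IsProjectiveHom 0ℤ P (λ a i → V a i - N · Φ a i)
primitive-difference N {F} {V} {Φ} V-prim Φ-prim = isProjectiveHom λ {a} {b} Pa Pb → Constant-cong
  (λ i → regroup N (F a b i) (Φ b i) (Φ (a * b) i) (Φ a (b ·ₚ i))
    (V b i) (V (a * b) i) (V a (b ·ₚ i)))
  (Constant-· N (bounds Φ-prim Pa Pb) ⟨-⟩ bounds V-prim Pa Pb)
  where
  regroup : ∀ m f p q r p′ q′ r′ → m · (f - (p - q + r)) - (m · f - (p′ - q′ + r′))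
    ≡ p′ - m · p - (q′ - m · q) + (r′ - m · r)
  regroup = solve-∀

fixed-points-gap-additive : {P : Pred (Perm n) 0ℓ} {D : PointCochain₁ n} → IsProjectiveHom N P D →
  ∀ {a b i j} → P a → P b → b ·ₚ i ≡ i → b ·ₚ j ≡ j →
  D (a * b) i - D (a * b) j ≈ (D a i - D a j) + (D b i - D b j) [mod N ]
fixed-points-gap-additive {D = D} D-hom {a} {b} {i} {j} Pa Pb bi≡i bj≡j =
  ≈-by-difference (u≈u (defect-constant D-hom Pa Pb) j i)
    (trans (cong₂ (λ k l → D b j - D (a * b) j + D a k - (D b i - D (a * b) i + D a l)) bj≡j bi≡i)
      (regroup (D (a * b) i) (D a i) (D b i) (D (a * b) j) (D a j) (D b j)))
  where
  regroup : ∀ ab a b ab′ a′ b′ → b′ - ab′ + a′ - (b - ab + a) ≡ (ab - ab′) - ((a - a′) + (b - b′))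
  regroup = solve-∀

-- The gap D (aᵏ) i - D (aᵏ) j is affine in k and takes the same value at 0 and at q.
torsion-agrees : {D : PointCochain₁ n} {a : Perm n} {q : ℕ} .{{_ : ℕ.NonZero q}} {i j : Fin n} →
  IsProjectiveHom 0ℤ (Powers a) D → a ^ₚ q ≡ idP → a ·ₚ i ≡ i → a ·ₚ j ≡ j → D a i ≡ D a j
torsion-agrees {n} {D} {a} {q} {i} {j} D-hom a^q≡1 ai≡i aj≡j = ℤₚ.i-j≡0⇒i≡j (D a i) (D a j) gap≡0
  where
  open ≡-Reasoning
  gap : Perm n → ℤ
  gap b = D b i - D b j
  gap-^ₚ : ∀ k → gap (a ^ₚ k) ≡ ℤ.+ k · gap a + gap idP
  gap-^ₚ zero = sym (ℤₚ.+-identityˡ (gap idP))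
  gap-^ₚ (suc k) = begin
    gap (a * (a ^ₚ k))
      ≡⟨ ≈[mod0]⇒≡ (fixed-points-gap-additive D-hom (1 , sym (*-identityʳ a)) (k , refl)
           (^ₚ-fix a ai≡i k) (^ₚ-fix a aj≡j k)) ⟩
    gap a + gap (a ^ₚ k)                      ≡⟨ cong (gap a +_) (gap-^ₚ k) ⟩
    gap a + (ℤ.+ k · gap a + gap idP)         ≡⟨ suc-· (ℤ.+ k) (gap a) (gap idP) ⟩
    ℤ.+ suc k · gap a + gap idP               ∎
    where
    suc-· : ∀ k d z → d + (k · d + z) ≡ (1ℤ + k) · d + z
    suc-· = solve-∀
  q·gap≡0 : ℤ.+ q · gap a ≡ 0ℤ
  q·gap≡0 = begin
    ℤ.+ q · gap a                             ≡⟨ add-subtract (ℤ.+ q · gap a) (gap idP) ⟩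
    ℤ.+ q · gap a + gap idP - gap idP         ≡⟨ cong (_- gap idP) (gap-^ₚ q) ⟨
    gap (a ^ₚ q) - gap idP                    ≡⟨ cong (λ b → gap b - gap idP) a^q≡1 ⟩
    gap idP - gap idP                         ≡⟨ ℤₚ.+-inverseʳ (gap idP) ⟩
    0ℤ                                        ∎
    where
    add-subtract : ∀ x y → x ≡ x + y - y
    add-subtract = solve-∀
  gap≡0 : gap a ≡ 0ℤ
  gap≡0 with ℤₚ.i*j≡0⇒i≡0∨j≡0 (ℤ.+ q) q·gap≡0
  ... | inj₁ q≡0 = contradiction (ℤₚ.+-injective q≡0) (ℕ.≢-nonZero⁻¹ q)
  ... | inj₂ gap≡0 = gap≡0

coboundary-on-powers⇒agrees : (N : ℤ) {a : Perm n} {q : ℕ} .{{_ : ℕ.NonZero q}}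
  {F : PointCochain₂ n} {V : PointCochain₁ n} →
  a ^ₚ q ≡ idP → IsPrimitive (Powers a) (N • F) V → IsCoboundary (Powers a) F →
  ∀ {i j} → a ·ₚ i ≡ i → a ·ₚ j ≡ j → V a i ≈ V a j [mod N ]
coboundary-on-powers⇒agrees N {a} {q} {V = V} a^q≡1 V-prim (Φ , Φ-prim) {i} {j} ai≡i aj≡j =
  ≈-by-difference (u≈u (Constant-multiple {u = Φ a}) i j) (sym (begin
    V a i - V a j
      ≡⟨ regroup N (V a i) (V a j) (Φ a i) (Φ a j) ⟩
    D a i - D a j + (N · Φ a i - N · Φ a j)
      ≡⟨ cong (_+ (N · Φ a i - N · Φ a j)) (ℤₚ.i≡j⇒i-j≡0 D-agrees) ⟩
    0ℤ + (N · Φ a i - N · Φ a j)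
      ≡⟨ ℤₚ.+-identityˡ _ ⟩
    N · Φ a i - N · Φ a j ∎))
  where
  open ≡-Reasoning
  D : PointCochain₁ _
  D b l = V b l - N · Φ b l
  D-agrees : D a i ≡ D a j
  D-agrees = torsion-agrees {D = D} {q = q} (primitive-difference N V-prim Φ-prim) a^q≡1 ai≡i aj≡j
  regroup : ∀ m v v′ f f′ → v - v′ ≡ (v - m · f - (v′ - m · f′)) + (m · f - m · f′)
  regroup = solve-∀

-- Splitting over an abelian group

-- The canonical splitting of the central extension over the stabilizer of o.
based : PointCochain₁ n → Fin n → PointCochain₁ n
based V o x i = V x i - V x o

-- The commutator pairing of the central extension.
pairing : PointCochain₁ n → PointCochain₂ n
pairing V a b i = V a (b ·ₚ i) - V a i - (V b (a ·ₚ i) - V b i)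

Commute : ℤ → PointCochain₁ n → Perm n → Perm n → Set
Commute N V a b = ∀ i → pairing V a b i ≈ 0ℤ [mod N ]

module _ (S : Subgroup n) {V : PointCochain₁ n} (V-hom : IsProjectiveHom N (_∈ˢ S) V) where

  based-isCrossedHom : (o : Fin n) → IsCrossedHom N (_∈ˢ stabilizer S o) (based V o)
  based-isCrossedHom o = isCrossedHom λ {a} {b} a∈ b∈ i →
    let (a∈S , _) = stabilizer⁻ S o a∈ ; (b∈S , bo≡o) = stabilizer⁻ S o b∈ in
    ≈-by-difference (u≈u (defect-constant V-hom a∈S b∈S) o i)
      (trans (cong (λ j → V b o - V (a * b) o + V a j - δ V a b i) bo≡o)
        (regroup (V b o) (V (a * b) o) (V a o) (V b i) (V (a * b) i) (V a (b ·ₚ i))))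
    where
    regroup : ∀ b ab a b′ ab′ a′ →
      b - ab + a - (b′ - ab′ + a′) ≡ (ab′ - ab) - ((a′ - a) + (b′ - b))
    regroup = solve-∀

  based-vanishes : AgreesOnFixedPoints N (_∈ˢ S) V → (o : Fin n) →
    VanishesOnFixedPoints N (_∈ˢ stabilizer S o) (based V o)
  based-vanishes agrees o {a} {i} a∈ ai≡i = let (a∈S , ao≡o) = stabilizer⁻ S o a∈ in
    ≈-by-difference (agrees a∈S ai≡i ao≡o) (sym (ℤₚ.+-identityʳ (V a i - V a o)))

  module _ (abelian : IsAbelian S) where

    pairing-constant : ∀ {a b} → a ∈ˢ S → b ∈ˢ S → Constant N (pairing V a b)
    pairing-constant {a} {b} a∈ b∈ = Constant-cong
      (λ i → trans (cong (λ c → δ V a b i - (V a i - V c i + V b (a ·ₚ i))) (abelian b∈ a∈))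
        (regroup (V b i) (V (a * b) i) (V a (b ·ₚ i)) (V a i) (V b (a ·ₚ i))))
      (defect-constant V-hom a∈ b∈ ⟨-⟩ defect-constant V-hom b∈ a∈)
      where
      regroup : ∀ b ab a′ a b′ → b - ab + a′ - (a - ab + b′) ≡ (a′ - a) - (b′ - b)
      regroup = solve-∀

    common-fixed-point⇒commute : ∀ {a b j} → a ∈ˢ S → b ∈ˢ S → a ·ₚ j ≡ j → b ·ₚ j ≡ j →
      Commute N V a b
    common-fixed-point⇒commute {a} {b} {j} a∈ b∈ aj≡j bj≡j i = begin
      pairing V a b i                    ≈⟨ u≈u (pairing-constant a∈ b∈) i j ⟩
      pairing V a b j                    ≡⟨ cong₂ (λ k l → V a k - V a j - (V b l - V b j)) bj≡j aj≡j ⟩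
      V a j - V a j - (V b j - V b j)    ≡⟨ cancel (V a j) (V b j) ⟩
      0ℤ                                 ∎
      where
      open ≈-Reasoning (mod-setoid N)
      cancel : ∀ x y → x - x - (y - y) ≡ 0ℤ
      cancel = solve-∀

    commute-* : ∀ {y z x} → y ∈ˢ S → z ∈ˢ S → x ∈ˢ S →
      Commute N V y x → Commute N V z x → Commute N V (y * z) x
    commute-* {y} {z} {x} y∈ z∈ x∈ yx zx i = ≈-by-difference
      (≈-+ (≈-+ (u≈u (defect-constant V-hom y∈ z∈) i (x ·ₚ i)) (yx (z ·ₚ i))) (zx i))
      (trans (cong₂ (λ j k → δ V y z i
                 + (V y (x ·ₚ (z ·ₚ i)) - V y (z ·ₚ i) - (V x j - V x (z ·ₚ i))) + pairing V z x i
                 - (V z (x ·ₚ i) - V (y * z) (x ·ₚ i) + V y k + 0ℤ + 0ℤ))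
               (sym (*-act y z i)) zxi≡xzi)
        (regroup (V (y * z) (x ·ₚ i)) (V y (x ·ₚ (z ·ₚ i))) (V z (x ·ₚ i)) (V x (z ·ₚ i))
          (V x ((y * z) ·ₚ i)) (V y (z ·ₚ i)) (V x i) (V z i) (V (y * z) i)))
      where
      zxi≡xzi : z ·ₚ (x ·ₚ i) ≡ x ·ₚ (z ·ₚ i)
      zxi≡xzi = trans (sym (*-act z x i)) (trans (cong (_·ₚ i) (abelian z∈ x∈)) (*-act x z i))
      regroup : ∀ yzx yxz zx xz xyz yz x z yzi →
        z - yzi + yz + (yxz - yz - (xyz - xz)) + (zx - z - (xz - x)) - (zx - yzx + yxz + 0ℤ + 0ℤ)
        ≡ (yzx - yzi) - (xyz - x) - 0ℤ
      regroup = solve-∀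

module AbelianSplitting {S : Subgroup n} (abelian : IsAbelian S) {V : PointCochain₁ n}
  (V-hom : IsProjectiveHom N (_∈ˢ S) V) (agrees : AgreesOnFixedPoints N (_∈ˢ S) V)
  (swept : OrbitsSweptByPowers S) (dual : DualSystem S 3) where

  open DualSystem dual

  i₁ i₂ i₃ : Fin n
  i₁ = point 0F
  i₂ = point 1F
  i₃ = point 2F

  τ : PointCochain₁ n
  τ = based V i₁

  τ-cong : ∀ {x y} → x ∈ˢ S → x ·ₚ i₁ ≡ i₁ → y ∈ˢ S → y ·ₚ i₁ ≡ i₁ → x ·ₚ i₃ ≡ y ·ₚ i₃ →
    τ x i₃ ≈ τ y i₃ [mod N ]
  τ-cong x∈ xi₁≡i₁ y∈ yi₁≡i₁ = crossedHom-cong (stabilizer S i₁) (based-isCrossedHom S V-hom i₁)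
    (based-vanishes S V-hom agrees i₁) (stabilizer⁺ S i₁ x∈ xi₁≡i₁) (stabilizer⁺ S i₁ y∈ yi₁≡i₁)

  τ-* : ∀ {x y} → x ∈ˢ S → x ·ₚ i₁ ≡ i₁ → y ∈ˢ S → y ·ₚ i₁ ≡ i₁ →
    τ (x * y) i₃ ≈ τ x (y ·ₚ i₃) + τ y i₃ [mod N ]
  τ-* x∈ xi₁≡i₁ y∈ yi₁≡i₁ =
    homo (based-isCrossedHom S V-hom i₁) (stabilizer⁺ S i₁ x∈ xi₁≡i₁) (stabilizer⁺ S i₁ y∈ yi₁≡i₁) i₃

  -- a is the product of an element fixing i₂ and an element fixing i₁, and x fixes both points.
  stabilizer₁₂-central : ∀ {a x} → a ∈ˢ S → x ∈ˢ S → x ·ₚ i₁ ≡ i₁ → x ·ₚ i₂ ≡ i₂ →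
    Commute N V a x
  stabilizer₁₂-central {a} {x} a∈ x∈ xi₁≡i₁ xi₂≡i₂
    with y , y∈ , yi₁≡ai₁ , y-fixes ← component swept 0F a∈ =
    subst (λ b → Commute N V b x) (a[a⁻¹b]≡b S y∈ a)
      (commute-* S V-hom abelian y∈ z∈ x∈
        (common-fixed-point⇒commute S V-hom abelian y∈ x∈ (y-fixes {1F} λ ()) xi₂≡i₂)
        (common-fixed-point⇒commute S V-hom abelian z∈ x∈ (⁻¹*-fix S y∈ a (sym yi₁≡ai₁)) xi₁≡i₁))
    where
    z∈ : (y ⁻¹ * a) ∈ˢ S
    z∈ = mul-closed S (⁻¹-closed S y∈) a∈

  record IsThirdComponent (a x : Perm n) : Set where
    field
      x∈     : x ∈ˢ S
      x-act₃ : x ·ₚ i₃ ≡ a ·ₚ i₃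
      x-fix₁ : x ·ₚ i₁ ≡ i₁
      x-fix₂ : x ·ₚ i₂ ≡ i₂

  abstract
    third-component : ∃ λ (x : Perm n → Perm n) → ∀ {a} → a ∈ˢ S → IsThirdComponent a (x a)
    third-component = choose S {P = IsThirdComponent} idP λ a∈ →
      let (x , x∈ , eq , fixes) = component swept 2F a∈ in
      x , record { x∈ = x∈ ; x-act₃ = eq ; x-fix₁ = fixes (λ ()) ; x-fix₂ = fixes (λ ()) }

  x : Perm n → Perm n
  x = proj₁ third-component

  open module ThirdComponent {a : Perm n} (a∈ : a ∈ˢ S) =
    IsThirdComponent (proj₂ third-component a∈)

  x-*-act₃ : ∀ {a b} → a ∈ˢ S → b ∈ˢ S → (x b * x a) ·ₚ i₃ ≡ (a * b) ·ₚ i₃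
  x-*-act₃ {a} {b} a∈ b∈ = begin
    (x b * x a) ·ₚ i₃      ≡⟨ *-act (x b) (x a) i₃ ⟩
    x b ·ₚ (x a ·ₚ i₃)     ≡⟨ cong (x b ·ₚ_) (x-act₃ a∈) ⟩
    x b ·ₚ (a ·ₚ i₃)       ≡⟨ *-act (x b) a i₃ ⟨
    (x b * a) ·ₚ i₃        ≡⟨ cong (_·ₚ i₃) (abelian (x∈ b∈) a∈) ⟩
    (a * x b) ·ₚ i₃        ≡⟨ *-act a (x b) i₃ ⟩
    a ·ₚ (x b ·ₚ i₃)       ≡⟨ cong (a ·ₚ_) (x-act₃ b∈) ⟩
    a ·ₚ (b ·ₚ i₃)         ≡⟨ *-act a b i₃ ⟨
    (a * b) ·ₚ i₃          ∎
    where open ≡-Reasoning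

  open ≈-Reasoning (mod-setoid N)

  -- V a corrected by a constant: writing a = x z with x fixing i₁, i₂ and z fixing i₃,
  -- this is the product in the central extension of the canonical lifts of x and z.
  σ : PointCochain₁ n
  σ a i = V a i - V a i₃ + τ (x a) i₃

  σ-at-i₃ : ∀ {a y} → a ∈ˢ S → y ∈ˢ S → y ·ₚ i₁ ≡ i₁ → y ·ₚ i₃ ≡ a ·ₚ i₃ →
    σ a i₃ ≈ τ y i₃ [mod N ]
  σ-at-i₃ {a} {y} a∈ y∈ yi₁≡i₁ yi₃≡ai₃ = begin
    V a i₃ - V a i₃ + τ (x a) i₃   ≡⟨ cong (_+ τ (x a) i₃) (ℤₚ.+-inverseʳ (V a i₃)) ⟩
    0ℤ + τ (x a) i₃                ≡⟨ ℤₚ.+-identityˡ (τ (x a) i₃) ⟩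
    τ (x a) i₃
      ≈⟨ τ-cong (x∈ a∈) (x-fix₁ a∈) y∈ yi₁≡i₁ (trans (x-act₃ a∈) (sym yi₃≡ai₃)) ⟩
    τ y i₃                         ∎

  σ-*-at-i₃ : ∀ {a b} → a ∈ˢ S → b ∈ˢ S → σ (a * b) i₃ ≈ σ a (b ·ₚ i₃) + σ b i₃ [mod N ]
  σ-*-at-i₃ {a} {b} a∈ b∈ = begin
    σ (a * b) i₃
      ≈⟨ σ-at-i₃ (mul-closed S a∈ b∈) (mul-closed S (x∈ b∈) (x∈ a∈))
           (*-fix (x b) (x a) (x-fix₁ b∈) (x-fix₁ a∈)) (x-*-act₃ a∈ b∈) ⟩
    τ (x b * x a) i₃
      ≈⟨ τ-* (x∈ b∈) (x-fix₁ b∈) (x∈ a∈) (x-fix₁ a∈) ⟩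
    τ (x b) (x a ·ₚ i₃) + τ (x a) i₃
      ≡⟨ cong (λ j → τ (x b) j + τ (x a) i₃) (x-act₃ a∈) ⟩
    τ (x b) (a ·ₚ i₃) + τ (x a) i₃
      ≈⟨ ≈-by-difference (stabilizer₁₂-central a∈ (x∈ b∈) (x-fix₁ b∈) (x-fix₂ b∈) i₃)
           (regroup (V a (x b ·ₚ i₃)) (V a i₃) (V (x b) (a ·ₚ i₃)) (V (x b) i₃) (V (x b) i₁)
             (τ (x a) i₃) (V b i₃)) ⟨
    σ a (x b ·ₚ i₃) + σ b i₃
      ≡⟨ cong (λ j → σ a j + σ b i₃) (x-act₃ b∈) ⟩
    σ a (b ·ₚ i₃) + σ b i₃ ∎
    where
    regroup : ∀ axb a xba xb xb₁ t b → (axb - a - (xba - xb)) - 0ℤ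
      ≡ ((axb - a + t) + (b - b + (xb - xb₁))) - ((xba - xb₁) + t)
    regroup = solve-∀

  σ-isCrossedHom : IsCrossedHom N (_∈ˢ S) σ
  σ-isCrossedHom = isCrossedHom λ {a} {b} a∈ b∈ i → ≈-by-difference
    (≈-+ (u≈u (defect-constant V-hom a∈ b∈) i₃ i) (σ-*-at-i₃ a∈ b∈))
    (regroup (V b i) (V (a * b) i) (V a (b ·ₚ i)) (V b i₃) (V (a * b) i₃) (V a (b ·ₚ i₃))
      (V a i₃) (τ (x a) i₃) (τ (x b) i₃) (τ (x (a * b)) i₃))
    where
    regroup : ∀ b ab a b₃ ab₃ a₃ a₀ ta tb tab →
      (b₃ - ab₃ + a₃) + (ab₃ - ab₃ + tab) - ((b - ab + a) + ((a₃ - a₀ + ta) + (b₃ - b₃ + tb)))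
      ≡ (ab - ab₃ + tab) - ((a - a₀ + ta) + (b - b₃ + tb))
    regroup = solve-∀

  VanishesOnStabilizer : Fin n → Set
  VanishesOnStabilizer j = ∀ {a} → a ∈ˢ S → a ·ₚ j ≡ j → ∀ {i} → a ·ₚ i ≡ i → σ a i ≈ 0ℤ [mod N ]

  σ-vanishes-at-all-fixed-points : ∀ {a} → a ∈ˢ S → ∀ {i j} → a ·ₚ i ≡ i → a ·ₚ j ≡ j →
    σ a i ≈ 0ℤ [mod N ] → σ a j ≈ 0ℤ [mod N ]
  σ-vanishes-at-all-fixed-points {a} a∈ {i} {j} ai≡i aj≡j σai≈0 = begin
    σ a j    ≈⟨ ≈-+ (≈-- (agrees a∈ aj≡j ai≡i) (≈-refl {x = V a i₃})) (≈-refl {x = τ (x a) i₃}) ⟩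
    σ a i    ≈⟨ σai≈0 ⟩
    0ℤ       ∎

  σ-vanishes-on-product : ∀ {a c i} → a ∈ˢ S → c ∈ˢ S → a ·ₚ i ≡ i → c ·ₚ i ≡ i →
    σ c i ≈ 0ℤ [mod N ] → σ (c ⁻¹ * a) i ≈ 0ℤ [mod N ] → σ a i ≈ 0ℤ [mod N ]
  σ-vanishes-on-product {a} {c} {i} a∈ c∈ ai≡i ci≡i σc≈0 σd≈0 = begin
    σ a i                   ≡⟨ cong (λ b → σ b i) (a[a⁻¹b]≡b S c∈ a) ⟨
    σ (c * d) i             ≈⟨ homo σ-isCrossedHom c∈ (mul-closed S (⁻¹-closed S c∈) a∈) i ⟩
    σ c (d ·ₚ i) + σ d i    ≡⟨ cong (λ j → σ c j + σ d i) (⁻¹*-fix S c∈ a (trans ai≡i (sym ci≡i))) ⟩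
    σ c i + σ d i           ≈⟨ ≈-+ σc≈0 σd≈0 ⟩
    0ℤ                      ∎
    where
    d : Perm n
    d = c ⁻¹ * a

  vanishes-on-stabilizer₁ : VanishesOnStabilizer i₁
  vanishes-on-stabilizer₁ {a} a∈ ai₁≡i₁ ai≡i = σ-vanishes-at-all-fixed-points a∈ ai₁≡i₁ ai≡i
    (≈-by-difference (τ-cong (x∈ a∈) (x-fix₁ a∈) a∈ ai₁≡i₁ (x-act₃ a∈))
      (regroup (V a i₁) (V a i₃) (τ (x a) i₃)))
    where
    regroup : ∀ v₁ v₃ t → t - (v₃ - v₁) ≡ (v₁ - v₃ + t) - 0ℤ
    regroup = solve-∀

  vanishes-on-stabilizer₃ : VanishesOnStabilizer i₃
  vanishes-on-stabilizer₃ {a} a∈ ai₃≡i₃ ai≡i = σ-vanishes-at-all-fixed-points a∈ ai₃≡i₃ ai≡i (begin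
    σ a i₃
      ≈⟨ σ-at-i₃ a∈ (x∈ a∈) (x-fix₁ a∈) (x-act₃ a∈) ⟩
    τ (x a) i₃
      ≈⟨ based-vanishes S V-hom agrees i₁ (stabilizer⁺ S i₁ (x∈ a∈) (x-fix₁ a∈))
           (trans (x-act₃ a∈) ai₃≡i₃) ⟩
    0ℤ ∎)

  σ-vanishes-if-x-fixes : ∀ {a i} → a ∈ˢ S → a ·ₚ i ≡ i → x a ·ₚ i ≡ i → σ a i ≈ 0ℤ [mod N ]
  σ-vanishes-if-x-fixes {a} a∈ ai≡i xi≡i = σ-vanishes-on-product a∈ (x∈ a∈) ai≡i xi≡i
    (vanishes-on-stabilizer₁ (x∈ a∈) (x-fix₁ a∈) xi≡i)
    (vanishes-on-stabilizer₃ (mul-closed S (⁻¹-closed S (x∈ a∈)) a∈)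
      (⁻¹*-fix S (x∈ a∈) a (sym (x-act₃ a∈))) (⁻¹*-fix S (x∈ a∈) a (trans ai≡i (sym xi≡i))))

  vanishes-on-stabilizer₂ : VanishesOnStabilizer i₂
  vanishes-on-stabilizer₂ a∈ ai₂≡i₂ ai≡i =
    σ-vanishes-at-all-fixed-points a∈ ai₂≡i₂ ai≡i (σ-vanishes-if-x-fixes a∈ ai₂≡i₂ (x-fix₂ a∈))

  -- If x a moves i, its powers sweep the orbit of i, so a is the product of an element y (x a)ᵏ
  -- fixing i and i₂ and of an element fixing i and i₁.
  σ-vanishes : VanishesOnFixedPoints N (_∈ˢ S) σ
  σ-vanishes {a} {i} a∈ ai≡i with (x a ·ₚ i) Finₚ.≟ i
  ... | yes xi≡i = σ-vanishes-if-x-fixes a∈ ai≡i xi≡i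
  ... | no x-moves
    with y , y∈ , yi₁≡ai₁ , y-fixes ← component swept 0F a∈
    with k , ci≡i ← adjust-to-fix S swept (x∈ a∈) y∈ x-moves =
    σ-vanishes-on-product a∈ c∈ ai≡i ci≡i
      (vanishes-on-stabilizer₂ c∈
        (*-fix y (x a ^ₚ k) (y-fixes λ ()) (^ₚ-fix (x a) (x-fix₂ a∈) k)) ci≡i)
      (vanishes-on-stabilizer₁ (mul-closed S (⁻¹-closed S c∈) a∈)
        (⁻¹*-fix S c∈ a (sym ci₁≡ai₁)) (⁻¹*-fix S c∈ a (trans ai≡i (sym ci≡i))))
    where
    c : Perm n
    c = y * (x a ^ₚ k)
    c∈ : c ∈ˢ S
    c∈ = mul-closed S y∈ (^ₚ-closed S (x∈ a∈) k)
    ci₁≡ai₁ : c ·ₚ i₁ ≡ a ·ₚ i₁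
    ci₁≡ai₁ = trans (*-act y (x a ^ₚ k) i₁)
      (trans (cong (y ·ₚ_) (^ₚ-fix (x a) (x-fix₁ a∈) k)) yi₁≡ai₁)

  splits : ∃ (SplitsBy N (_∈ˢ S) V)
  splits = let (w , σ-principal) = crossedHom-principal S σ-isCrossedHom σ-vanishes in
    w , λ {a} a∈ → constant λ i j → ≈-by-difference (≈-- (σ-principal a∈ i) (σ-principal a∈ j))
      (regroup (V a i) (V a j) (V a i₃) (τ (x a) i₃) (δ₀ w a i) (δ₀ w a j))
    where
    regroup : ∀ u v v₃ t d e → (u - v₃ + t - (v - v₃ + t)) - (d - e) ≡ (u - d) - (v - e)
    regroup = solve-∀

-- Elementary abelian groups

module ElementaryAbelian {p : ℕ} (pr : Prime p) {m : ℕ}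
  (S : Subgroup n) (iso : IsoToCpPower p pr m S) where

  instance
    p≢0 : ℕ.NonZero p
    p≢0 = prime⇒nonZero pr

  1<p : 1 ℕ.< p
  1<p = ℕ.nonTrivial⇒n>1 p {{prime⇒nonTrivial pr}}

  ι : Vec (Fin p) m → Perm n
  ι = proj₁ iso

  ι∈ : ∀ u → ι u ∈ˢ S
  ι∈ = proj₁ (proj₂ iso)

  ι-onto : ∀ {s} → s ∈ˢ S → ∃[ u ] (ι u ≡ s)
  ι-onto = proj₁ (proj₂ (proj₂ iso))

  ι-injective : ∀ u v → ι u ≡ ι v → u ≡ v
  ι-injective = proj₁ (proj₂ (proj₂ (proj₂ iso)))

  infixl 6 _⊞_
  _⊞_ : ∀ {l} → Vec (Fin p) l → Vec (Fin p) l → Vec (Fin p) l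
  _⊞_ = _+ᶜ_ p

  ι-homo : ∀ u v → ι (u ⊞ v) ≡ ι u * ι v
  ι-homo = proj₂ (proj₂ (proj₂ (proj₂ iso)))

  toℕ-mod : ∀ k → toℕ (k mod p) ≡ k % p
  toℕ-mod k = Finₚ.toℕ-fromℕ< (m%n<n k p)

  mod-cong : ∀ {k l} → k % p ≡ l % p → k mod p ≡ l mod p
  mod-cong {k} {l} eq = Finₚ.toℕ-injective (trans (toℕ-mod k) (trans eq (sym (toℕ-mod l))))

  mod-toℕ : ∀ (a : Fin p) → toℕ a mod p ≡ a
  mod-toℕ a = Finₚ.toℕ-injective (trans (toℕ-mod (toℕ a)) (m<n⇒m%n≡m (Finₚ.toℕ<n a)))

  mod-homo-+ : ∀ k l → (toℕ (k mod p) ℕ.+ toℕ (l mod p)) mod p ≡ (k ℕ.+ l) mod p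
  mod-homo-+ k l = mod-cong (trans (cong₂ (λ x y → (x ℕ.+ y) % p) (toℕ-mod k) (toℕ-mod l))
    (sym (%-distribˡ-+ k l p)))

  infixr 7 _⊡_
  _⊡_ : ∀ {l} → ℕ → Vec (Fin p) l → Vec (Fin p) l
  k ⊡ u = Vec.map (λ a → (k ℕ.* toℕ a) mod p) u

  ⊞-comm : ∀ {l} (u v : Vec (Fin p) l) → u ⊞ v ≡ v ⊞ u
  ⊞-comm [] [] = refl
  ⊞-comm (a ∷ u) (b ∷ v) = cong₂ _∷_ (cong (_mod p) (ℕₚ.+-comm (toℕ a) (toℕ b))) (⊞-comm u v)

  ⊡-distribʳ-+ : ∀ {l} j k (u : Vec (Fin p) l) → (j ℕ.+ k) ⊡ u ≡ j ⊡ u ⊞ k ⊡ u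
  ⊡-distribʳ-+ j k [] = refl
  ⊡-distribʳ-+ j k (a ∷ u) = cong₂ _∷_
    (trans (cong (_mod p) (ℕₚ.*-distribʳ-+ (toℕ a) j k))
      (sym (mod-homo-+ (j ℕ.* toℕ a) (k ℕ.* toℕ a))))
    (⊡-distribʳ-+ j k u)

  ⊡-identity : ∀ {l} (u : Vec (Fin p) l) → 1 ⊡ u ≡ u
  ⊡-identity [] = refl
  ⊡-identity (a ∷ u) =
    cong₂ _∷_ (trans (cong (_mod p) (ℕₚ.*-identityˡ (toℕ a))) (mod-toℕ a)) (⊡-identity u)

  p⊡u≡0⊡u : ∀ {l} (u : Vec (Fin p) l) → p ⊡ u ≡ 0 ⊡ u
  p⊡u≡0⊡u [] = refl
  p⊡u≡0⊡u (a ∷ u) = cong₂ _∷_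
    (mod-cong (trans (%-congˡ (ℕₚ.*-comm p (toℕ a))) (trans (m*n%n≡0 (toℕ a) p) (sym (m*n%n≡0 0 p)))))
    (p⊡u≡0⊡u u)

  ι-⊡ : ∀ k u → ι (k ⊡ u) ≡ ι u ^ₚ k
  ι-⊡ zero u = *-cancelˡ S (ι∈ (0 ⊡ u)) (begin
    ι (0 ⊡ u) * ι (0 ⊡ u)     ≡⟨ ι-homo (0 ⊡ u) (0 ⊡ u) ⟨
    ι (0 ⊡ u ⊞ 0 ⊡ u)         ≡⟨ cong ι (⊡-distribʳ-+ 0 0 u) ⟨
    ι (0 ⊡ u)                 ≡⟨ *-identityʳ (ι (0 ⊡ u)) ⟨
    ι (0 ⊡ u) * idP           ∎)
    where open ≡-Reasoning
  ι-⊡ (suc k) u = begin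
    ι (suc k ⊡ u)             ≡⟨ cong ι (⊡-distribʳ-+ 1 k u) ⟩
    ι (1 ⊡ u ⊞ k ⊡ u)         ≡⟨ ι-homo (1 ⊡ u) (k ⊡ u) ⟩
    ι (1 ⊡ u) * ι (k ⊡ u)     ≡⟨ cong₂ _*_ (cong ι (⊡-identity u)) (ι-⊡ k u) ⟩
    ι u * (ι u ^ₚ k)          ∎
    where open ≡-Reasoning

  abelian : IsAbelian S
  abelian a∈ b∈ with u , refl ← ι-onto a∈ with v , refl ← ι-onto b∈ =
    trans (sym (ι-homo u v)) (trans (cong ι (⊞-comm u v)) (ι-homo v u))

  exponent : HasExponent p S
  exponent e∈ with u , refl ← ι-onto e∈ =
    trans (sym (ι-⊡ p u)) (trans (cong ι (p⊡u≡0⊡u u)) (ι-⊡ 0 u))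

  common-stabilizers-nontrivial : OrbitsBoundedBy p S →
    ∀ {k} → k ℕ.< m → CommonStabilizersNontrivial S k
  common-stabilizers-nontrivial bounded k<m = bounded-orbits⇒common-stabilizers-nontrivial S bounded
    (λ x → ι (tabulate (finToFun x))) (λ x → ι∈ _) injective (ℕₚ.^-monoʳ-< p 1<p k<m)
    where
    injective : Injective _≡_ _≡_ (λ (x : Fin (p ^ m)) → ι (tabulate (finToFun x)))
    injective {x} {y} eq = finToFun-injective m x y λ j → begin
      finToFun x j                        ≡⟨ lookup∘tabulate (finToFun x) j ⟨
      lookup (tabulate (finToFun x)) j    ≡⟨ cong (λ u → lookup u j) (ι-injective _ _ eq) ⟩
      lookup (tabulate (finToFun y)) j    ≡⟨ lookup∘tabulate (finToFun y) j ⟩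
      finToFun y j                        ∎
      where open ≡-Reasoning

rank≤1⇒cyclic : {p m : ℕ} (pr : Prime p) → m ℕ.≤ 1 → (S : Subgroup n) → IsoToCpPower p pr m S →
  ∃[ g ] (g ∈ˢ S × (∀ {s} → s ∈ˢ S → Powers g s))
rank≤1⇒cyclic {m = 0} pr _ S iso = ι [] , ι∈ [] , generates
  where
  open ElementaryAbelian pr S iso
  generates : ∀ {s} → s ∈ˢ S → Powers (ι []) s
  generates s∈ with [] , refl ← ι-onto s∈ = 1 , sym (*-identityʳ (ι []))
rank≤1⇒cyclic {p = p} {m = 1} pr _ S iso = ι (1 mod p ∷ []) , ι∈ _ , generates
  where
  open ElementaryAbelian pr S iso
  open ≡-Reasoning
  scale-one : ∀ a → (toℕ a ℕ.* toℕ (1 mod p)) mod p ≡ a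
  scale-one a = begin
    (toℕ a ℕ.* toℕ (1 mod p)) mod p
      ≡⟨ cong (λ x → (toℕ a ℕ.* x) mod p) (trans (toℕ-mod 1) (m<n⇒m%n≡m 1<p)) ⟩
    (toℕ a ℕ.* 1) mod p               ≡⟨ cong (_mod p) (ℕₚ.*-identityʳ (toℕ a)) ⟩
    toℕ a mod p                       ≡⟨ mod-toℕ a ⟩
    a                                 ∎
  generates : ∀ {s} → s ∈ˢ S → Powers (ι (1 mod p ∷ [])) s
  generates s∈ with a ∷ [] , refl ← ι-onto s∈ = toℕ a , (begin
    ι (a ∷ [])                        ≡⟨ cong (λ b → ι (b ∷ [])) (scale-one a) ⟨
    ι (toℕ a ⊡ (1 mod p ∷ []))        ≡⟨ ι-⊡ (toℕ a) (1 mod p ∷ []) ⟩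
    ι (1 mod p ∷ []) ^ₚ toℕ a         ∎)
rank≤1⇒cyclic {m = suc (suc _)} _ (ℕ.s≤s ())

CoboundaryOnCyclicSubgroups : Subgroup n → PointCochain₂ n → Set
CoboundaryOnCyclicSubgroups K F = ∀ {a} → a ∈ˢ K → IsCoboundary (Powers a) F

module _ {p m : ℕ} (pr : Prime p) (S : Subgroup n) (iso : IsoToCpPower p pr m S)
  {F : PointCochain₂ n} (on-cyclic : CoboundaryOnCyclicSubgroups S F) where

  rank≤1⇒coboundary : m ℕ.≤ 1 → IsCoboundary (_∈ˢ S) F
  rank≤1⇒coboundary m≤1
    with g , g∈ , generates ← rank≤1⇒cyclic pr m≤1 S iso
    with Φ , Φ-prim ← on-cyclic g∈ = Φ , IsPrimitive-⊆ generates Φ-prim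

  rank≥3⇒coboundary : Fin n → 3 ℕ.≤ m → OrbitsBoundedBy p S → IsCocycle (_∈ˢ S) F →
    IsCoboundary (_∈ˢ S) F
  rank≥3⇒coboundary i₀ 3≤m bounded F-cocycle =
    let (V , V-prim) = order-multiple-coboundary S F-cocycle in
    splits⇒coboundary S |S| {{|S|≢0}} i₀ V-prim
      (AbelianSplitting.splits abelian (primitive⇒projectiveHom |S| V-prim)
        (λ a∈ → coboundary-on-powers⇒agrees |S| (exponent a∈)
          (IsPrimitive-⊆ (λ { (k , refl) → ^ₚ-closed S a∈ k }) V-prim) (on-cyclic a∈))
        swept
        (dualSystem S swept (common-stabilizers-nontrivial bounded) 3 3≤m))
    where
    open ElementaryAbelian pr S iso
    |S| : ℤ
    |S| = ℤ.+ order S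
    |S|≢0 : ℤ.NonZero |S|
    |S|≢0 = ℕ.>-nonZero (∈-length (has-id S))
    swept : OrbitsSweptByPowers S
    swept = bounded-orbits⇒swept pr S exponent bounded

  elementary-abelian⇒coboundary : Fin n → m ≢ 2 → OrbitsBoundedBy p S → IsCocycle (_∈ˢ S) F →
    IsCoboundary (_∈ˢ S) F
  elementary-abelian⇒coboundary i₀ m≢2 bounded F-cocycle with m ℕ.≤? 1
  ... | yes m≤1 = rank≤1⇒coboundary m≤1
  ... | no m≰1 = rank≥3⇒coboundary i₀ (ℕₚ.≤∧≢⇒< (ℕₚ.≰⇒> m≰1) (m≢2 ∘ sym)) bounded F-cocycle

sylow-index-coprime : ∀ {p} → Prime p → (G S : Subgroup n) (sylow : IsSylow p G S) → ∀ k →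
  Coprime (length (Cosets.cosetReps G S (proj₁ sylow))) (p ^ k)
sylow-index-coprime {p = p} pr G S (S≤G , v , r , _ , |G|≡|S|r , p∤r) =
  coprime-^ʳ (∤⇒coprime pr (subst (λ t → ¬ (p ∣ t)) (sym index≡r) p∤r))
  where
  open Cosets G S S≤G
  index≡r : length cosetReps ≡ r
  index≡r = ℕₚ.*-cancelˡ-≡ _ r (order S) {{ℕ.>-nonZero (∈-length (has-id S))}}
    (trans order-*-index |G|≡|S|r)

theorem6p10 :
    (p : ℕ) (pr : Prime p) (n : ℕ) →
    p ∣ n → ¬ (p ^ 2 ∣ n) →
    (G H : Subgroup n) → IsTransitive G →
    (i₀ : Fin n) → IsPointStabilizer G H i₀ →
    (S : Subgroup n) → IsSylow p G S → IsNormal G S →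
    (m : ℕ) → m ≢ 2 → IsoToCpPower p pr m S →
    (𝒟 : List (Subgroup n)) → IsAdmissible G 𝒟 →
    (f : Cochain2 n) → Is2Cocycle G H f →
    (∀ {D} → D ∈ 𝒟 → IsCoboundaryOn G H D f) →
    (∃[ k ] IsCoboundaryOn G H G (scale2 (p ^ k) f)) →
    IsCoboundaryOn G H G f
theorem6p10 p pr n _ p²∤n G H transitive i₀ stab S sylow@(S≤G , v , _ , |S|≡p^v , _) normal m m≢2 iso
  𝒟 (𝒟≤G , cyclic∈𝒟 , _) f f-cocycle local (k , p^k-torsion) =
  fromPoints-coboundary (proj₁ f-cocycle)
    (coprime-multiples-coboundary (sylow-index-coprime pr G S sylow k)
      (transfer G S S≤G F-cocycle F-on-S)
      (toPoints-coboundary G id p^k-torsion))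
  where
  open Points G H transitive i₀ stab
  F : PointCochain₂ n
  F = toPoints₂ f
  F-cocycle : IsCocycle (_∈ˢ G) F
  F-cocycle = toPoints-cocycle f-cocycle
  F-on-cyclic : CoboundaryOnCyclicSubgroups S F
  F-on-cyclic a∈
    with D , D∈ , generates ← find (cyclic∈𝒟 (S≤G a∈))
    with Φ , Φ-prim ← toPoints-coboundary D (𝒟≤G D∈) (local D∈) =
    Φ , IsPrimitive-⊆ (Equivalence.from (generates _)) Φ-prim
  F-on-S : IsCoboundary (_∈ˢ S) F
  F-on-S = elementary-abelian⇒coboundary pr S iso F-on-cyclic i₀ m≢2
    (normal-p-subgroup-orbits-bounded {v = v} pr p²∤n G S transitive normal |S|≡p^v)
    (IsCocycle-⊆ S≤G F-cocycle)
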